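{- For every integer $d\geq 2$ there exist $\epsilon=\epsilon(d)>0$ and $\eta=\eta(d)>0$ such that the following holds. Let $X$ be a distance-regular graph of diameter $d$ on $n$ vertices and degree $k$. If $k_t\geq (1-\epsilon)n$ for some $t\in\{1,\dots,d\}$, then the zero-weight spectral radius $\xi$ of $X$ satisfies $\xi\leq k(1-\eta)$.
   Context: A connected graph $X$ of diameter $d$ is distance-regular if there are integers $a_i,b_i,c_i$ ($0\le i\le d$) such that for all vertices $v,w$ with $\mathrm{dist}(v,w)=i$, the vertex $w$ has exactly $c_i$ neighbours at distance $i-1$ from $v$, $a_i$ neighbours at distance $i$ from $v$, and $b_i$ neighbours at distance $i+1$ from $v$. Then $X$ is $k$-regular with $k=b_0$, $c_0=b_d=0$, $c_1=1$ and $a_i+b_i+c_i=k$. For $0\le i\le d$, $k_i$ denotes the number of vertices at distance exactly $i$ from a fixed vertex (independent of the vertex). If the eigenvalues of the adjacency matrix of a $k$-regular graph on $n$ vertices are $k=\xi_1\geq\xi_2\geq\dots\geq\xi_n$, the zero-weight spectral radius is $\xi=\max\{|\xi_i|:2\le i\le n\}$. -}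

module Defs where

open import Data.Fin.Base using (Fin; toℕ)
open import Data.Fin.Subset using (Subset; _∈_; ∣_∣)
open import Data.Integer.Base using (+_)
open import Data.Nat.Base as ℕ using (ℕ; suc)
import Data.Nat.Properties as ℕ
open import Data.Product.Base using (Σ; ∃; ∃-syntax; _×_; _,_)
open import Data.Rational.Base as ℚ using (ℚ; 0ℚ; 1ℚ; ½)
import Data.Rational.Properties as ℚ
open import Data.Rational.Solver using (module +-*-Solver)
open import Data.Bool.Base using (if_then_else_)
open import Data.Sum.Base using (inj₁; inj₂)
open import Data.Vec.Functional using (foldr)
open import Function.Bundles using (_⇔_)
open import Relation.Binary.Core using (Rel)
open import Relation.Binary.Definitions using (Decidable; Symmetric; Irreflexive)
open import Relation.Binary.PropositionalEquality using (_≡_; refl; sym; trans; cong; cong₂; subst)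
open import Relation.Nullary.Decidable.Core using (does)
open import Level using (0ℓ)

-- Real numbers: Cauchy sequences of rationals (with modulus), as a setoid
-- under _≈ℝ_.

IsCauchy : (ℕ → ℚ) → Set
IsCauchy s = ∀ ε → 0ℚ ℚ.< ε →
  ∃[ N ] (∀ m n → N ℕ.≤ m → N ℕ.≤ n → ℚ.∣ s m ℚ.- s n ∣ ℚ.≤ ε)

record ℝ : Set where
  constructor mkℝ
  field
    seq    : ℕ → ℚ
    cauchy : IsCauchy seq

open ℝ public

infix 4 _≈ℝ_ _≤ℝ_ _<ℝ_

-- Records rather than plain functions, so that x and y can be inferred.
record _≈ℝ_ (x y : ℝ) : Set where
  constructor mk≈
  field
    approx : ∀ ε → 0ℚ ℚ.< ε →
      ∃[ N ] (∀ n → N ℕ.≤ n → ℚ.∣ seq x n ℚ.- seq y n ∣ ℚ.≤ ε)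

record _≤ℝ_ (x y : ℝ) : Set where
  constructor mk≤
  field
    bound : ∀ ε → 0ℚ ℚ.< ε →
      ∃[ N ] (∀ n → N ℕ.≤ n → seq x n ℚ.≤ seq y n ℚ.+ ε)

record _<ℝ_ (x y : ℝ) : Set where
  constructor mk<
  field
    gap       : ℚ
    gap-pos   : 0ℚ ℚ.< gap
    separated : ∃[ N ] (∀ n → N ℕ.≤ n → seq x n ℚ.+ gap ℚ.≤ seq y n)

private
  abstract
    half-pos : ∀ {ε} → 0ℚ ℚ.< ε → 0ℚ ℚ.< ½ ℚ.* ε
    half-pos {ε} 0<ε = subst (ℚ._< ½ ℚ.* ε) (ℚ.*-zeroʳ ½) (ℚ.*-monoʳ-<-pos ½ 0<ε)

    half+half : ∀ ε → ½ ℚ.* ε ℚ.+ ½ ℚ.* ε ≡ ε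
    half+half ε = trans (sym (ℚ.*-distribʳ-+ ε ½ ½)) (ℚ.*-identityˡ ε)

    cauchy-const : ∀ q → IsCauchy (λ _ → q)
    cauchy-const q ε 0<ε = 0 , λ _ _ _ _ →
      subst (λ z → ℚ.∣ z ∣ ℚ.≤ ε) (sym (ℚ.+-inverseʳ q)) (ℚ.<⇒≤ 0<ε)

    cauchy-+ : ∀ {s t} → IsCauchy s → IsCauchy t → IsCauchy (λ n → s n ℚ.+ t n)
    cauchy-+ {s} {t} cs ct ε 0<ε with cs (½ ℚ.* ε) (half-pos 0<ε) | ct (½ ℚ.* ε) (half-pos 0<ε)
    ... | M , p | N , q = M ℕ.⊔ N , λ m n hm hn → begin
        ℚ.∣ (s m ℚ.+ t m) ℚ.- (s n ℚ.+ t n) ∣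
          ≡⟨ cong ℚ.∣_∣ (solve 4 (λ a b c d → (a :+ b) :- (c :+ d) := (a :- c) :+ (b :- d)) refl (s m) (t m) (s n) (t n)) ⟩
        ℚ.∣ (s m ℚ.- s n) ℚ.+ (t m ℚ.- t n) ∣
          ≤⟨ ℚ.∣p+q∣≤∣p∣+∣q∣ (s m ℚ.- s n) (t m ℚ.- t n) ⟩
        ℚ.∣ s m ℚ.- s n ∣ ℚ.+ ℚ.∣ t m ℚ.- t n ∣
          ≤⟨ ℚ.+-mono-≤ (p m n (ℕ.m⊔n≤o⇒m≤o M N hm) (ℕ.m⊔n≤o⇒m≤o M N hn))
                        (q m n (ℕ.m⊔n≤o⇒n≤o M N hm) (ℕ.m⊔n≤o⇒n≤o M N hn)) ⟩
        ½ ℚ.* ε ℚ.+ ½ ℚ.* ε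
          ≡⟨ half+half ε ⟩
        ε ∎
      where
        open ℚ.≤-Reasoning
        open +-*-Solver

    cauchy-neg : ∀ {s} → IsCauchy s → IsCauchy (λ n → ℚ.- s n)
    cauchy-neg {s} cs ε 0<ε with cs ε 0<ε
    ... | N , p = N , λ m n hm hn → subst (ℚ._≤ ε) (sym (eq m n)) (p m n hm hn)
      where
        open +-*-Solver
        eq : ∀ m n → ℚ.∣ (ℚ.- s m) ℚ.- (ℚ.- s n) ∣ ≡ ℚ.∣ s m ℚ.- s n ∣
        eq m n = trans
          (cong ℚ.∣_∣ (solve 2 (λ a b → (:- a) :- (:- b) := :- (a :- b)) refl (s m) (s n)))
          (ℚ.∣-p∣≡∣p∣ (s m ℚ.- s n))

    ∣∣-lipschitz : ∀ a b → ℚ.∣ a ∣ ℚ.≤ ℚ.∣ a ℚ.- b ∣ ℚ.+ ℚ.∣ b ∣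
    ∣∣-lipschitz a b = subst (λ z → ℚ.∣ z ∣ ℚ.≤ ℚ.∣ a ℚ.- b ∣ ℚ.+ ℚ.∣ b ∣)
      (solve 2 (λ x y → (x :- y) :+ y := x) refl a b)
      (ℚ.∣p+q∣≤∣p∣+∣q∣ (a ℚ.- b) b)
      where open +-*-Solver

    move : ∀ {x y z} → x ℚ.≤ z ℚ.+ y → x ℚ.- y ℚ.≤ z
    move {x} {y} {z} h = subst (x ℚ.- y ℚ.≤_)
      (solve 2 (λ z y → (z :+ y) :- y := z) refl z y) (ℚ.+-monoˡ-≤ (ℚ.- y) h)
      where open +-*-Solver

    ∣∣a∣-∣b∣∣≤ : ∀ a b → ℚ.∣ ℚ.∣ a ∣ ℚ.- ℚ.∣ b ∣ ∣ ℚ.≤ ℚ.∣ a ℚ.- b ∣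
    ∣∣a∣-∣b∣∣≤ a b with ℚ.∣p∣≡p∨∣p∣≡-p (ℚ.∣ a ∣ ℚ.- ℚ.∣ b ∣)
    ... | inj₁ eq = subst (ℚ._≤ ℚ.∣ a ℚ.- b ∣) (sym eq) (move (∣∣-lipschitz a b))
    ... | inj₂ eq = subst (ℚ._≤ ℚ.∣ a ℚ.- b ∣) (sym eq′) (move h)
      where
        open +-*-Solver
        eq′ : ℚ.∣ ℚ.∣ a ∣ ℚ.- ℚ.∣ b ∣ ∣ ≡ ℚ.∣ b ∣ ℚ.- ℚ.∣ a ∣
        eq′ = trans eq (solve 2 (λ x y → :- (x :- y) := y :- x) refl ℚ.∣ a ∣ ℚ.∣ b ∣)
        h : ℚ.∣ b ∣ ℚ.≤ ℚ.∣ a ℚ.- b ∣ ℚ.+ ℚ.∣ a ∣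
        h = subst (λ z → ℚ.∣ b ∣ ℚ.≤ z ℚ.+ ℚ.∣ a ∣)
          (trans (cong ℚ.∣_∣ (solve 2 (λ x y → y :- x := :- (x :- y)) refl a b)) (ℚ.∣-p∣≡∣p∣ (a ℚ.- b)))
          (∣∣-lipschitz b a)

    cauchy-∣∣ : ∀ {s} → IsCauchy s → IsCauchy (λ n → ℚ.∣ s n ∣)
    cauchy-∣∣ {s} cs ε 0<ε with cs ε 0<ε
    ... | N , p = N , λ m n hm hn → ℚ.≤-trans (∣∣a∣-∣b∣∣≤ (s m) (s n)) (p m n hm hn)

    cauchy-bounded : ∀ {s} → IsCauchy s →
      ∃[ N ] ∃[ B ] (0ℚ ℚ.≤ B × (∀ n → N ℕ.≤ n → ℚ.∣ s n ∣ ℚ.≤ B))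
    cauchy-bounded {s} cs with cs 1ℚ (ℚ.positive⁻¹ 1ℚ)
    ... | N , p = N , 1ℚ ℚ.+ ℚ.∣ s N ∣ ,
      ℚ.+-mono-≤ (ℚ.nonNegative⁻¹ 1ℚ) (ℚ.0≤∣p∣ (s N)) ,
      λ n hn → ℚ.≤-trans (∣∣-lipschitz (s n) (s N))
                         (ℚ.+-monoˡ-≤ ℚ.∣ s N ∣ (p n N hn ℕ.≤-refl))

    mul-mono : ∀ {a b c d} → 0ℚ ℚ.≤ a → 0ℚ ℚ.≤ d → a ℚ.≤ b → c ℚ.≤ d → a ℚ.* c ℚ.≤ b ℚ.* d
    mul-mono {a} {b} {c} {d} 0≤a 0≤d a≤b c≤d = ℚ.≤-trans
      (ℚ.*-monoˡ-≤-nonNeg a {{ℚ.nonNegative 0≤a}} c≤d)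
      (ℚ.*-monoʳ-≤-nonNeg d {{ℚ.nonNegative 0≤d}} a≤b)

    split : ∀ {B ε} → 0ℚ ℚ.≤ B → 0ℚ ℚ.< ε → ∃[ δ ] (0ℚ ℚ.< δ × B ℚ.* δ ℚ.≤ ε)
    split {B} {ε} 0≤B 0<ε = δ , ℚ.positive⁻¹ δ {{δ>0}} , (begin
        B ℚ.* δ   ≤⟨ ℚ.*-monoʳ-≤-nonNeg δ {{ℚ.nonNegative (ℚ.<⇒≤ (ℚ.positive⁻¹ δ {{δ>0}}))}} B≤C ⟩
        C ℚ.* δ   ≡⟨ ℚ.*-assoc C C⁻¹ ε ⟨
        C ℚ.* C⁻¹ ℚ.* ε ≡⟨ cong (ℚ._* ε) (ℚ.*-inverseʳ C {{C≢0}}) ⟩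
        1ℚ ℚ.* ε  ≡⟨ ℚ.*-identityˡ ε ⟩
        ε ∎)
      where
        open ℚ.≤-Reasoning
        C C⁻¹ δ : ℚ
        C = 1ℚ ℚ.+ B
        C>0 : ℚ.Positive C
        C>0 = ℚ.positive (ℚ.+-mono-<-≤ (ℚ.positive⁻¹ 1ℚ) 0≤B)
        C≢0 : ℚ.NonZero C
        C≢0 = ℚ.pos⇒nonZero C {{C>0}}
        C⁻¹ = (ℚ.1/ C) {{C≢0}}
        δ = C⁻¹ ℚ.* ε
        δ>0 : ℚ.Positive δ
        δ>0 = ℚ.pos*pos⇒pos C⁻¹ {{ℚ.1/pos⇒pos C {{C>0}}}} ε {{ℚ.positive 0<ε}}
        B≤C : B ℚ.≤ C
        B≤C = subst (ℚ._≤ C) (ℚ.+-identityˡ B) (ℚ.+-monoˡ-≤ B (ℚ.nonNegative⁻¹ 1ℚ))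

    mul-sub : ∀ a b c → a ℚ.* (b ℚ.- c) ≡ a ℚ.* b ℚ.- a ℚ.* c
    mul-sub a b c = trans (ℚ.*-distribˡ-+ a b (ℚ.- c))
                          (cong (a ℚ.* b ℚ.+_) (sym (ℚ.neg-distribʳ-* a c)))

    telescope : ∀ x y z → x ℚ.- z ≡ (x ℚ.- y) ℚ.+ (y ℚ.- z)
    telescope = solve 3 (λ x y z → x :- z := (x :- y) :+ (y :- z)) refl
      where open +-*-Solver

    mul-split : ∀ a b c d → a ℚ.* b ℚ.- c ℚ.* d ≡ a ℚ.* (b ℚ.- d) ℚ.+ d ℚ.* (a ℚ.- c)
    mul-split a b c d = trans (telescope (a ℚ.* b) (a ℚ.* d) (c ℚ.* d))
      (cong₂ ℚ._+_ (sym (mul-sub a b d))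
        (sym (trans (mul-sub d a c) (cong₂ ℚ._-_ (ℚ.*-comm d a) (ℚ.*-comm d c)))))

    mul-bound : ∀ {B C δ γ} a b c d → 0ℚ ℚ.≤ δ → 0ℚ ℚ.≤ γ →
      ℚ.∣ a ∣ ℚ.≤ B → ℚ.∣ d ∣ ℚ.≤ C → ℚ.∣ b ℚ.- d ∣ ℚ.≤ δ → ℚ.∣ a ℚ.- c ∣ ℚ.≤ γ →
      ℚ.∣ a ℚ.* b ℚ.- c ℚ.* d ∣ ℚ.≤ B ℚ.* δ ℚ.+ C ℚ.* γ
    mul-bound {B} {C} {δ} {γ} a b c d 0≤δ 0≤γ hB hC hδ hγ = begin
      ℚ.∣ a ℚ.* b ℚ.- c ℚ.* d ∣
        ≡⟨ cong ℚ.∣_∣ (mul-split a b c d) ⟩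
      ℚ.∣ a ℚ.* (b ℚ.- d) ℚ.+ d ℚ.* (a ℚ.- c) ∣
        ≤⟨ ℚ.∣p+q∣≤∣p∣+∣q∣ (a ℚ.* (b ℚ.- d)) (d ℚ.* (a ℚ.- c)) ⟩
      ℚ.∣ a ℚ.* (b ℚ.- d) ∣ ℚ.+ ℚ.∣ d ℚ.* (a ℚ.- c) ∣
        ≡⟨ cong₂ ℚ._+_ (ℚ.∣p*q∣≡∣p∣*∣q∣ a (b ℚ.- d)) (ℚ.∣p*q∣≡∣p∣*∣q∣ d (a ℚ.- c)) ⟩
      ℚ.∣ a ∣ ℚ.* ℚ.∣ b ℚ.- d ∣ ℚ.+ ℚ.∣ d ∣ ℚ.* ℚ.∣ a ℚ.- c ∣
        ≤⟨ ℚ.+-mono-≤ (mul-mono (ℚ.0≤∣p∣ a) 0≤δ hB hδ) (mul-mono (ℚ.0≤∣p∣ d) 0≤γ hC hγ) ⟩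
      B ℚ.* δ ℚ.+ C ℚ.* γ ∎
      where open ℚ.≤-Reasoning

    cauchy-* : ∀ {s t} → IsCauchy s → IsCauchy t → IsCauchy (λ n → s n ℚ.* t n)
    cauchy-* {s} {t} cs ct ε 0<ε =
      let K , B , 0≤B , hB = cauchy-bounded cs
          L , C , 0≤C , hC = cauchy-bounded ct
          δ , 0<δ , Bδ = split 0≤B (half-pos 0<ε)
          γ , 0<γ , Cγ = split 0≤C (half-pos 0<ε)
          M , p = ct δ 0<δ
          N , q = cs γ 0<γ
          KL≤ : ∀ {m} → (K ℕ.⊔ L) ℕ.⊔ (M ℕ.⊔ N) ℕ.≤ m → K ℕ.⊔ L ℕ.≤ m
          KL≤ = ℕ.m⊔n≤o⇒m≤o (K ℕ.⊔ L) (M ℕ.⊔ N)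
          MN≤ : ∀ {m} → (K ℕ.⊔ L) ℕ.⊔ (M ℕ.⊔ N) ℕ.≤ m → M ℕ.⊔ N ℕ.≤ m
          MN≤ = ℕ.m⊔n≤o⇒n≤o (K ℕ.⊔ L) (M ℕ.⊔ N)
      in (K ℕ.⊔ L) ℕ.⊔ (M ℕ.⊔ N) , λ m n hm hn →
        ℚ.≤-trans
          (mul-bound (s m) (t m) (s n) (t n) (ℚ.<⇒≤ 0<δ) (ℚ.<⇒≤ 0<γ)
            (hB m (ℕ.m⊔n≤o⇒m≤o K L (KL≤ hm)))
            (hC n (ℕ.m⊔n≤o⇒n≤o K L (KL≤ hn)))
            (p m n (ℕ.m⊔n≤o⇒m≤o M N (MN≤ hm)) (ℕ.m⊔n≤o⇒m≤o M N (MN≤ hn)))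
            (q m n (ℕ.m⊔n≤o⇒n≤o M N (MN≤ hm)) (ℕ.m⊔n≤o⇒n≤o M N (MN≤ hn))))
          (ℚ.≤-trans (ℚ.+-mono-≤ Bδ Cγ) (ℚ.≤-reflexive (half+half ε)))

infixl 6 _+ℝ_ _-ℝ_
infixl 7 _*ℝ_
infix  8 -ℝ_

_+ℝ_ _*ℝ_ : ℝ → ℝ → ℝ
x +ℝ y = mkℝ (λ n → seq x n ℚ.+ seq y n) (cauchy-+ {seq x} {seq y} (cauchy x) (cauchy y))
x *ℝ y = mkℝ (λ n → seq x n ℚ.* seq y n) (cauchy-* {seq x} {seq y} (cauchy x) (cauchy y))

-ℝ_ ∣_∣ℝ : ℝ → ℝ
-ℝ x    = mkℝ (λ n → ℚ.- seq x n) (cauchy-neg {seq x} (cauchy x))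
∣ x ∣ℝ  = mkℝ (λ n → ℚ.∣ seq x n ∣) (cauchy-∣∣ {seq x} (cauchy x))

_-ℝ_ : ℝ → ℝ → ℝ
x -ℝ y = x +ℝ (-ℝ y)

fromℚ : ℚ → ℝ
fromℚ q = mkℝ (λ _ → q) (cauchy-const q)

fromℕ : ℕ → ℝ
fromℕ m = fromℚ (+ m ℚ./ 1)

0ℝ 1ℝ : ℝ
0ℝ = fromℚ 0ℚ
1ℝ = fromℚ 1ℚ

sumℝ : ∀ {n} → (Fin n → ℝ) → ℝ
sumℝ = foldr _+ℝ_ 0ℝ

record Graph (n : ℕ) : Set₁ where
  field
    Adj        : Rel (Fin n) 0ℓ
    adj?       : Decidable Adj
    adj-sym    : Symmetric Adj
    adj-irrefl : Irreflexive _≡_ Adj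

open Graph public

HasCard : ∀ {n} → (Fin n → Set) → ℕ → Set
HasCard {n} P m = Σ (Subset n) λ S → (∣ S ∣ ≡ m) × (∀ v → v ∈ S ⇔ P v)

module _ {n : ℕ} (X : Graph n) where

  data Walk : Fin n → Fin n → ℕ → Set where
    nil  : ∀ {u} → Walk u u 0
    cons : ∀ {u v w m} → Adj X u v → Walk v w m → Walk u w (suc m)

  Connected : Set
  Connected = ∀ u v → ∃ (Walk u v)

  Dist : Fin n → Fin n → ℕ → Set
  Dist u v i = Walk u v i × (∀ j → Walk u v j → i ℕ.≤ j)

  HasDiameter : ℕ → Set
  HasDiameter d = (∀ u v i → Dist u v i → i ℕ.≤ d) × (∃[ u ] ∃[ v ] Dist u v d)

  Regular : ℕ → Set
  Regular k = ∀ v → HasCard (Adj X v) k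

  -- Distances never exceed the diameter d, so the values of a, b, c
  -- beyond d are unconstrained.  In c-count, "distance i - 1" is read so
  -- that it is impossible for i = 0.
  record IsIntersectionArray (a b c : ℕ → ℕ) : Set where
    field
      c-count : ∀ i v w → Dist v w i →
                HasCard (λ u → Adj X w u × (∃[ j ] (suc j ≡ i × Dist v u j))) (c i)
      a-count : ∀ i v w → Dist v w i →
                HasCard (λ u → Adj X w u × Dist v u i) (a i)
      b-count : ∀ i v w → Dist v w i →
                HasCard (λ u → Adj X w u × Dist v u (suc i)) (b i)

  record IsDistanceRegular (d : ℕ) : Set where
    field
      connected : Connected
      diameter  : HasDiameter d
      a b c     : ℕ → ℕ
      array     : IsIntersectionArray a b c

  SphereSize : Fin n → ℕ → ℕ → Set
  SphereSize v t m = HasCard (λ w → Dist v w t) m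

  adjacency : Fin n → Fin n → ℝ
  adjacency u v = if does (adj? X u v) then 1ℝ else 0ℝ

matVec : ∀ {n} → (Fin n → Fin n → ℝ) → (Fin n → ℝ) → (Fin n → ℝ)
matVec M x u = sumℝ (λ v → M u v *ℝ x v)

LinearlyIndependent : ∀ {m n} → (Fin m → Fin n → ℝ) → Set
LinearlyIndependent {m} {n} x =
  ∀ (coeff : Fin m → ℝ) →
  (∀ u → sumℝ (λ i → coeff i *ℝ x i u) ≈ℝ 0ℝ) → ∀ i → coeff i ≈ℝ 0ℝ

-- θ lists all n eigenvalues of the n × n matrix M, each repeated according
-- to the dimension of its eigenspace (M is diagonalisable in all uses).
record IsEigenvalueList {n : ℕ} (M : Fin n → Fin n → ℝ) (θ : Fin n → ℝ) : Set where
  field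
    eigenvector : Fin n → Fin n → ℝ
    independent : LinearlyIndependent eigenvector
    eigen       : ∀ i u → matVec M (eigenvector i) u ≈ℝ θ i *ℝ eigenvector i u

-- Index 0 of Fin n is the first eigenvalue; the maximum runs over the others.
record IsZeroWeightSpectralRadius {n : ℕ} (X : Graph n) (k : ℕ) (ξ : ℝ) : Set where
  field
    θ           : Fin n → ℝ
    eigenvalues : IsEigenvalueList (adjacency X) θ
    decreasing  : ∀ i j → toℕ i ℕ.≤ toℕ j → θ j ≤ℝ θ i
    principal   : ∀ i → toℕ i ≡ 0 → θ i ≈ℝ fromℕ k
    upper       : ∀ i → 1 ℕ.≤ toℕ i → ∣ θ i ∣ℝ ≤ℝ ξ
    attained    : ∃[ i ] (1 ℕ.≤ toℕ i × ξ ≈ℝ ∣ θ i ∣ℝ)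

module Submission where

-- Idea.  Write aᵢ, bᵢ, cᵢ for the intersection numbers and kᵢ for the sphere
-- sizes, and let kₜ ≥ (1 - ε) n.  From kᵢ bᵢ = kᵢ₊₁ cᵢ₊₁ and the monotonicity
-- of b and c one gets cᵢ ≪ bⱼ for all i ≤ t and j < t.
--
-- First, bᵢ ≥ bᵢ₋₁ / 4d for 0 < i < t, hence bᵢ ≥ k / Δ with Δ = (4d)^d.  Let
-- x, y, z lie on a geodesic with d(x,y) = i and d(y,z) = 1.  The endpoint of a
-- random geodesic of length i from y is uniform on the sphere Sᵢ(y), and each
-- step raises the distance to x (or to z) above i with probability at most
-- bᵢ / bᵢ₋₁.  Likewise a random geodesic from z ends within distance i of x with
-- probability O(cᵢ₊₁ / bᵢ₋₁).  If bᵢ were much smaller than bᵢ₋₁, then Sᵢ(y)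
-- and Sᵢ(z) would nearly coincide, and their common points would mostly be both
-- within distance i of x and not.
--
-- Secondly, let A f = θ f with ∑ f = 0 and |θ| ≥ k (1 - η), and let |f| have its
-- maximum m at u.  The mean of f over the sphere Sᵢ(u) satisfies the three-term
-- recurrence, and bᵢ ≥ k / Δ forces its absolute value to stay near m for
-- i ≤ t.  But Sₜ(u) is almost everything and ∑ f = 0, so the mean over Sₜ(u) is
-- at most m / 4 in absolute value, whence f = 0.  In quantitative form this holds
-- for the rational approximations of a real eigenvector, whose residuals tend to 0.
--
-- For an eigenvector x of θ the vector n x - ∑ x is again in the θ-eigenspace, as
-- (k - θ) ∑ x = 0.  So if |θᵢ| ≥ k (1 - η) for some i ≥ 1, then both the first and
-- the i-th eigenvector are constant, contradicting linear independence.

open import Defs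
open import Algebra.Bundles using (CommutativeRing; CommutativeSemiring)
import Algebra.Properties.Semiring.Sum as SemiringSum
open import Data.Empty using (⊥; ⊥-elim)
open import Data.Fin.Base using (Fin; zero; suc; toℕ)
import Data.Fin.Properties as Fin
open import Data.Fin.Subset using (Subset; _∈_; _∉_; ∣_∣; inside; outside; ⁅_⁆)
open import Data.Fin.Subset.Properties using (x∈⁅x⁆; x∈⁅y⁆⇒x≡y; ∣⁅x⁆∣≡1)
import Data.Integer.Base as ℤ
import Data.Integer.Properties as ℤ
open import Data.Nat.Base as ℕ using (ℕ; zero; suc; s≤s; z≤n; s≤s⁻¹; >-nonZero)
import Data.Nat.Properties as ℕ
open import Data.Nat.Tactic.RingSolver using (solve-∀)
open import Data.Product.Base using (∃; ∃-syntax; _×_; _,_; proj₁; proj₂)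
open import Data.Rational.Base as ℚ using (ℚ; 0ℚ; 1ℚ; ½)
import Data.Rational.Properties as ℚ
open import Data.Rational.Solver using (module +-*-Solver)
import Data.Rational.Unnormalised.Base as ℚᵘ
import Data.Rational.Unnormalised.Properties as ℚᵘ
open import Data.Sum.Base using (inj₁; inj₂)
open import Data.Vec.Base using ([]; _∷_; here; there)
open import Function.Base using (_∘_)
open import Function.Bundles using (Equivalence)
open import Relation.Binary.PropositionalEquality using (_≡_; _≢_; refl; sym; trans; cong; cong₂; subst; subst₂; module ≡-Reasoning)
open import Relation.Nullary.Decidable using (Dec; yes; no; _×-dec_; map′; from-yes)
open import Relation.Nullary.Negation using (¬_; contradiction)

module ∑ℕ = SemiringSum ℕ.+-*-semiring
module ℚR = CommutativeRing ℚ.+-*-commutativeRing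

-- Symmetric matrices are self-adjoint

module Adjoint {c ℓ} (R : CommutativeSemiring c ℓ) where
  private module R = CommutativeSemiring R
  open R using (Carrier; _≈_) renaming (_*_ to _⊛_)
  open SemiringSum R.semiring

  -- Exchange the order of summation and use the symmetry of `A`. The semiring is arbitrary because
  -- the identity serves both for counting edges in `ℕ` and for weighted sums in `ℚ`.
  adjoint : ∀ {n} (A : Fin n → Fin n → Carrier) → (∀ u v → A u v ≈ A v u) → (p q : Fin n → Carrier) →
    sum (λ w → p w ⊛ sum (λ z → A w z ⊛ q z)) ≈ sum (λ w → q w ⊛ sum (λ z → A w z ⊛ p z))
  adjoint A A-sym p q =
    R.trans (sum-cong-≋ λ w → *-distribˡ-sum (p w) (λ z → A w z ⊛ q z))
    (R.trans (∑-comm λ w z → p w ⊛ (A w z ⊛ q z))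
    (sum-cong-≋ λ z → R.trans (sum-cong-≋ λ w → exchange w z)
                       (R.sym (*-distribˡ-sum (q z) (λ w → A z w ⊛ p w)))))
    where
    exchange : ∀ w z → p w ⊛ (A w z ⊛ q z) ≈ q z ⊛ (A z w ⊛ p w)
    exchange w z = R.trans (R.*-comm _ _)
      (R.trans (R.*-congʳ (R.trans (R.*-comm _ _) (R.*-congˡ (A-sym w z)))) (R.*-assoc _ _ _))

module _ where

  open import Data.Nat.Base using (_+_; _*_; _^_; _≤_; _<_)
  open import Data.Nat.Properties
  open ∑ℕ using (sum; sum-cong-≗; ∑-distrib-+; *-distribˡ-sum; *-distribʳ-sum)

  -- Counting with sums of indicators

  sum-mono : ∀ {n} {f g : Fin n → ℕ} → (∀ i → f i ≤ g i) → sum f ≤ sum g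
  sum-mono {zero}  f≤g = z≤n
  sum-mono {suc n} f≤g = +-mono-≤ (f≤g zero) (sum-mono (f≤g ∘ suc))

  term≤sum : ∀ {n} (f : Fin n → ℕ) i → f i ≤ sum f
  term≤sum f zero    = m≤m+n _ _
  term≤sum f (suc i) = ≤-trans (term≤sum (f ∘ suc) i) (m≤n+m _ _)

  𝟙 : ∀ {p} {P : Set p} → Dec P → ℕ
  𝟙 (yes _) = 1
  𝟙 (no  _) = 0

  module _ {p} {P : Set p} where

    𝟙≤1 : (P? : Dec P) → 𝟙 P? ≤ 1
    𝟙≤1 (yes _) = ≤-refl
    𝟙≤1 (no  _) = z≤n

    𝟙-yes : (P? : Dec P) → P → 𝟙 P? ≡ 1
    𝟙-yes (yes _) _ = refl
    𝟙-yes (no ¬p) p = contradiction p ¬p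

    𝟙-no : (P? : Dec P) → ¬ P → 𝟙 P? ≡ 0
    𝟙-no (yes p) ¬p = contradiction p ¬p
    𝟙-no (no _)  _  = refl

    𝟙-guard : ∀ {x y} (P? : Dec P) → (P → x ≡ y) → 𝟙 P? * x ≡ 𝟙 P? * y
    𝟙-guard (yes p) x≡y = cong (1 *_) (x≡y p)
    𝟙-guard (no _)  _   = refl

    𝟙-guard-≤ : ∀ {x y} (P? : Dec P) → (P → x ≤ y) → 𝟙 P? * x ≤ 𝟙 P? * y
    𝟙-guard-≤ (yes p) x≤y = *-monoʳ-≤ 1 (x≤y p)
    𝟙-guard-≤ (no _)  _   = z≤n

  𝟙-×-yes : ∀ {p q} {P : Set p} {Q : Set q} (P? : Dec P) (Q? : Dec Q) → P × Q → 𝟙 P? * 𝟙 Q? ≡ 1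
  𝟙-×-yes P? Q? (p , q) rewrite 𝟙-yes P? p | 𝟙-yes Q? q = refl

  𝟙-×-no : ∀ {p q} {P : Set p} {Q : Set q} (P? : Dec P) (Q? : Dec Q) → ¬ (P × Q) → 𝟙 P? * 𝟙 Q? ≡ 0
  𝟙-×-no (no _)  _       _  = refl
  𝟙-×-no (yes _) (no _)  _  = refl
  𝟙-×-no (yes p) (yes q) ¬pq = contradiction (p , q) ¬pq

  𝟙-mono : ∀ {p q} {P : Set p} {Q : Set q} (P? : Dec P) (Q? : Dec Q) → (P → Q) → 𝟙 P? ≤ 𝟙 Q?
  𝟙-mono (no _)  _  _ = z≤n
  𝟙-mono (yes p) Q? f = ≤-reflexive (sym (𝟙-yes Q? (f p)))

  sum-subset : ∀ {n} (S : Subset n) (g : Fin n → ℕ) →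
    (∀ v → v ∈ S → g v ≡ 1) → (∀ v → v ∉ S → g v ≡ 0) → sum g ≡ ∣ S ∣
  sum-subset []            g g₁ g₀ = refl
  sum-subset (inside  ∷ S) g g₁ g₀ = cong₂ _+_ (g₁ zero here)
    (sum-subset S (g ∘ suc) (λ v → g₁ (suc v) ∘ there) (λ v v∉ → g₀ (suc v) λ { (there v∈) → v∉ v∈ }))
  sum-subset (outside ∷ S) g g₁ g₀ = cong₂ _+_ (g₀ zero λ ())
    (sum-subset S (g ∘ suc) (λ v → g₁ (suc v) ∘ there) (λ v v∉ → g₀ (suc v) λ { (there v∈) → v∉ v∈ }))

  -- Turns the cardinalities in the definitions into sums. The function `g` is only required to
  -- behave like an indicator of `P`, so that products of indicators can be used directly.
  sum-HasCard : ∀ {n m} {P : Fin n → Set} → HasCard P m → (g : Fin n → ℕ) →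
    (∀ v → P v → g v ≡ 1) → (∀ v → ¬ P v → g v ≡ 0) → sum g ≡ m
  sum-HasCard (S , ∣S∣≡m , S⇔P) g g₁ g₀ = trans
    (sum-subset S g (λ v v∈ → g₁ v (Equivalence.to (S⇔P v) v∈))
                    (λ v v∉ → g₀ v (v∉ ∘ Equivalence.from (S⇔P v))))
    ∣S∣≡m

  -- Walks and distances

  least : ∀ {p} {P : ℕ → Set p} → (∀ m → Dec (P m)) → ∀ m → P m → ∃[ i ] (P i × (∀ j → P j → i ≤ j))
  least P? zero    p = 0 , p , λ _ _ → z≤n
  least P? (suc m) p with P? 0
  ... | yes p₀ = 0 , p₀ , λ _ _ → z≤n
  ... | no ¬p₀ with least (P? ∘ suc) m p
  ...   | i , pᵢ , i-min = suc i , pᵢ , λ { zero p₀ → contradiction p₀ ¬p₀ ; (suc j) pⱼ → s≤s (i-min j pⱼ) }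

  module _ {n} (X : Graph n) where

    snoc : ∀ {u v w m} → Walk X u v m → Adj X v w → Walk X u w (suc m)
    snoc nil        vw = cons vw nil
    snoc (cons e p) vw = cons e (snoc p vw)

    unsnoc : ∀ {u w m} → Walk X u w (suc m) → ∃[ v ] (Walk X u v m × Adj X v w)
    unsnoc (cons e nil)          = _ , nil , e
    unsnoc (cons e p@(cons _ _)) with unsnoc p
    ... | v , q , vw = v , cons e q , vw

    walk? : ∀ m u v → Dec (Walk X u v m)
    walk? zero    u v = map′ (λ { refl → nil }) (λ { nil → refl }) (u Fin.≟ v)
    walk? (suc m) u v = map′ (λ { (_ , e , p) → cons e p }) (λ { (cons e p) → _ , e , p })
      (Fin.any? λ z → adj? X u z ×-dec walk? m z v)

    -- Walks of a fixed length are decidable, so the least length is found by searching upwards to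
    -- that of the walk given by connectedness.
    distance : Connected X → ∀ u v → ∃ (Dist X u v)
    distance conn u v = least (λ m → walk? m u v) _ (proj₂ (conn u v))

  module Metric {n} (X : Graph n) (dist : Fin n → Fin n → ℕ)
                (dist-Dist : ∀ u v → Dist X u v (dist u v)) where

    geodesic : ∀ u v → Walk X u v (dist u v)
    geodesic u v = proj₁ (dist-Dist u v)

    dist-≤ : ∀ {u v m} → Walk X u v m → dist u v ≤ m
    dist-≤ p = proj₂ (dist-Dist _ _) _ p

    Dist⇒≡ : ∀ {u v i} → Dist X u v i → dist u v ≡ i
    Dist⇒≡ (p , min) = ≤-antisym (dist-≤ p) (min _ (geodesic _ _))

    ≡⇒Dist : ∀ {u v i} → dist u v ≡ i → Dist X u v i
    ≡⇒Dist refl = dist-Dist _ _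

    dist-refl : ∀ u → dist u u ≡ 0
    dist-refl u = n≤0⇒n≡0 (dist-≤ nil)

    dist≡0 : ∀ {u v} → dist u v ≡ 0 → u ≡ v
    dist≡0 {u} {v} eq with dist u v | geodesic u v
    dist≡0 refl | zero | nil = refl

    dist-adj : ∀ {u v} → Adj X u v → dist u v ≡ 1
    dist-adj {u} {v} uv = ≤-antisym (dist-≤ (cons uv nil))
      (n≢0⇒n>0 λ eq → adj-irrefl X (dist≡0 eq) uv)

    dist-stepʳ : ∀ u {w z} → Adj X w z → dist u z ≤ suc (dist u w)
    dist-stepʳ u wz = dist-≤ (snoc X (geodesic u _) wz)

    dist-stepˡ : ∀ {u v} w → Adj X u v → dist u w ≤ suc (dist v w)
    dist-stepˡ w uv = dist-≤ (cons uv (geodesic _ w))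

    first-step : ∀ {u v i} → dist u v ≡ suc i → ∃[ u′ ] (Adj X u u′ × dist u′ v ≡ i)
    first-step {u} {v} {i} eq with subst (Walk X u v) eq (geodesic u v)
    ... | cons {v = u′} e p = u′ , e , ≤-antisym (dist-≤ p)
      (s≤s⁻¹ (≤-trans (≤-reflexive (sym eq)) (dist-stepˡ v e)))

    last-step : ∀ {u v i} → dist u v ≡ suc i → ∃[ v′ ] (dist u v′ ≡ i × Adj X v′ v)
    last-step {u} {v} {i} eq with unsnoc X (subst (Walk X u v) eq (geodesic u v))
    ... | v′ , p , e = v′ , ≤-antisym (dist-≤ p)
      (s≤s⁻¹ (≤-trans (≤-reflexive (sym eq)) (dist-stepʳ u e))) , e

    -- Removing the last step of a geodesic lowers the distance from `u` by exactly one, so every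
    -- smaller value is met on the way back.
    intermediate : ∀ {u v} i → i ≤ dist u v → ∃[ w ] (dist u w ≡ i)
    intermediate {u} {v} i i≤ = go (dist u v) refl i≤
      where
      go : ∀ {v} m → dist u v ≡ m → i ≤ m → ∃[ w ] (dist u w ≡ i)
      go zero    eq z≤n = _ , eq
      go (suc m) eq i≤  with m≤n⇒m<n∨m≡n i≤
      ... | inj₂ refl = _ , eq
      ... | inj₁ i<   with last-step eq
      ...   | _ , eq′ , _ = go m eq′ (s≤s⁻¹ i<)

  -- Spheres in a distance-regular graph

  sum-const : ∀ n x → sum {n} (λ _ → x) ≡ n * x
  sum-const zero    x = refl
  sum-const (suc n) x = cong (x +_) (sum-const n x)

  -- Here `i` is the distance of a vertex and `e` that of one of its neighbours. The inner layer is
  -- written `suc e ≟ i`, which fails by itself for `i = 0` and avoids truncated subtraction.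
  one-step : ∀ {e i} → i ≤ suc e → e ≤ suc i → 𝟙 (suc e ≟ i) + 𝟙 (e ≟ i) + 𝟙 (e ≟ suc i) ≡ 1
  one-step {e} {i} i≤ e≤ with m≤n⇒m<n∨m≡n i≤
  ... | inj₂ refl rewrite 𝟙-yes (suc e ≟ suc e) refl
                        | 𝟙-no (e ≟ suc e) (λ ())
                        | 𝟙-no (e ≟ suc (suc e)) (λ ()) = refl
  ... | inj₁ i<   with m≤n⇒m<n∨m≡n e≤
  ...   | inj₂ refl rewrite 𝟙-no (suc (suc i) ≟ i) (λ ())
                          | 𝟙-no (suc i ≟ i) (λ ())
                          | 𝟙-yes (suc i ≟ suc i) refl = refl
  ...   | inj₁ e<   with ≤-antisym (s≤s⁻¹ i<) (s≤s⁻¹ e<)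
  ...     | refl rewrite 𝟙-no (suc e ≟ e) (λ ())
                       | 𝟙-yes (e ≟ e) refl
                       | 𝟙-no (e ≟ suc e) (λ ()) = refl

  module DistanceRegular {n} (X : Graph n) (dist : Fin n → Fin n → ℕ)
    (dist-Dist : ∀ u v → Dist X u v (dist u v))
    {a b c : ℕ → ℕ} (array : IsIntersectionArray X a b c)
    {k : ℕ} (regular : Regular X k) {d : ℕ} (diameter : HasDiameter X d) where

    open Metric X dist dist-Dist
    open IsIntersectionArray array

    A : Fin n → Fin n → ℕ
    A u v = 𝟙 (adj? X u v)

    A-sym : ∀ u v → A u v ≡ A v u
    A-sym u v = ≤-antisym (𝟙-mono (adj? X u v) (adj? X v u) (adj-sym X))
                          (𝟙-mono (adj? X v u) (adj? X u v) (adj-sym X))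

    nb : (Fin n → ℕ) → Fin n → ℕ
    nb q w = sum (λ z → A w z * q z)

    nb-adjoint : ∀ p q → sum (λ w → p w * nb q w) ≡ sum (λ w → q w * nb p w)
    nb-adjoint = Adjoint.adjoint +-*-commutativeSemiring A A-sym

    nb-mono : ∀ {p q} w → (∀ z → Adj X w z → p z ≤ q z) → nb p w ≤ nb q w
    nb-mono w p≤q = sum-mono λ z → 𝟙-guard-≤ (adj? X w z) (p≤q z)

    -- I i u is the indicator of the sphere of radius i about u, and L i u that
    -- of the sphere of radius i - 1 (empty for i = 0).
    I L : ℕ → Fin n → Fin n → ℕ
    I i u w = 𝟙 (dist u w ≟ i)
    L i u w = 𝟙 (suc (dist u w) ≟ i)

    nb-a : ∀ {u w i} → dist u w ≡ i → nb (I i u) w ≡ a i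
    nb-a {u} {w} {i} eq = sum-HasCard (a-count i u w (≡⇒Dist eq)) _
      (λ z (wz , uz) → 𝟙-×-yes (adj? X w z) (dist u z ≟ i) (wz , Dist⇒≡ uz))
      (λ z ¬p → 𝟙-×-no (adj? X w z) (dist u z ≟ i) λ (wz , uz) → ¬p (wz , ≡⇒Dist uz))

    nb-b : ∀ {u w i} → dist u w ≡ i → nb (I (suc i) u) w ≡ b i
    nb-b {u} {w} {i} eq = sum-HasCard (b-count i u w (≡⇒Dist eq)) _
      (λ z (wz , uz) → 𝟙-×-yes (adj? X w z) (dist u z ≟ suc i) (wz , Dist⇒≡ uz))
      (λ z ¬p → 𝟙-×-no (adj? X w z) (dist u z ≟ suc i) λ (wz , uz) → ¬p (wz , ≡⇒Dist uz))

    nb-L : ∀ {u w i} → dist u w ≡ i → nb (L i u) w ≡ c i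
    nb-L {u} {w} {i} eq = sum-HasCard (c-count i u w (≡⇒Dist eq)) _
      (λ z (wz , j , sj≡i , uz) →
        𝟙-×-yes (adj? X w z) (suc (dist u z) ≟ i) (wz , trans (cong suc (Dist⇒≡ uz)) sj≡i))
      (λ z ¬p → 𝟙-×-no (adj? X w z) (suc (dist u z) ≟ i)
        λ (wz , uz) → ¬p (wz , _ , uz , ≡⇒Dist refl))

    nb-c : ∀ {u w i} → dist u w ≡ suc i → nb (I i u) w ≡ c (suc i)
    nb-c {u} {w} {i} eq = trans (sum-cong-≗ λ z → cong (A w z *_) (≤-antisym
      (𝟙-mono (dist u z ≟ i) (suc (dist u z) ≟ suc i) (cong suc))
      (𝟙-mono (suc (dist u z) ≟ suc i) (dist u z ≟ i) suc-injective))) (nb-L eq)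

    nb-1 : ∀ w → nb (λ _ → 1) w ≡ k
    nb-1 w = sum-HasCard (regular w) _
      (λ z wz → trans (*-identityʳ _) (𝟙-yes (adj? X w z) wz))
      (λ z ¬wz → trans (*-identityʳ _) (𝟙-no (adj? X w z) ¬wz))

    -- A geodesic between two vertices at distance `d` passes through every smaller distance.
    pair-at : ∀ {i} → i ≤ d → ∃[ u ] ∃[ w ] (dist u w ≡ i)
    pair-at {i} i≤d with proj₂ diameter
    ... | u , v , uv = u , intermediate i (≤-trans i≤d (≤-reflexive (sym (Dist⇒≡ uv))))

    -- The last vertex but one on a geodesic is among those that `c` counts.
    c-positive : ∀ {i} → suc i ≤ d → 1 ≤ c (suc i)
    c-positive {i} i<d with pair-at i<d
    ... | x , z , xz with last-step xz
    ...   | y , xy , yz = begin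
      1                        ≡⟨ 𝟙-×-yes (adj? X z y) (dist x y ≟ i) (adj-sym X yz , xy) ⟨
      A z y * I i x y          ≤⟨ term≤sum _ y ⟩
      nb (I i x) z             ≡⟨ nb-c xz ⟩
      c (suc i)                ∎
      where open ≤-Reasoning

    layers : ∀ {u w z i} → dist u w ≡ i → Adj X w z → L i u z + I i u z + I (suc i) u z ≡ 1
    layers {u} refl wz = one-step (dist-stepʳ u (adj-sym X wz)) (dist-stepʳ u wz)

    nb-+ : ∀ p q w → nb (λ z → p z + q z) w ≡ nb p w + nb q w
    nb-+ p q w = trans (sum-cong-≗ λ z → *-distribˡ-+ (A w z) (p z) (q z)) (∑-distrib-+ (λ z → A w z * p z) (λ z → A w z * q z))

    c+a+b≡k : ∀ {i} → i ≤ d → c i + a i + b i ≡ k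
    c+a+b≡k {i} i≤d with pair-at i≤d
    ... | u , w , uw = begin
      c i + a i + b i                                    ≡⟨ cong₂ _+_ (cong₂ _+_ (nb-L uw) (nb-a uw)) (nb-b uw) ⟨
      nb (L i u) w + nb (I i u) w + nb (I (suc i) u) w   ≡⟨ cong (_+ nb (I (suc i) u) w) (nb-+ (L i u) (I i u) w) ⟨
      nb (λ z → L i u z + I i u z) w + nb (I (suc i) u) w ≡⟨ nb-+ (λ z → L i u z + I i u z) (I (suc i) u) w ⟨
      nb (λ z → L i u z + I i u z + I (suc i) u z) w     ≡⟨ sum-cong-≗ (λ z → 𝟙-guard (adj? X w z) (layers uw)) ⟩
      nb (λ _ → 1) w                                     ≡⟨ nb-1 w ⟩
      k ∎
      where open ≡-Reasoning

    b₀≡k : b 0 ≡ k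
    b₀≡k with proj₂ diameter
    ... | u , _ = begin
      b 0              ≡⟨ nb-b (dist-refl u) ⟨
      nb (I 1 u) u     ≡⟨ sum-cong-≗ (λ z → 𝟙-guard (adj? X u z) λ uz → 𝟙-yes (dist u z ≟ 1) (dist-adj uz)) ⟩
      nb (λ _ → 1) u   ≡⟨ nb-1 u ⟩
      k ∎
      where open ≡-Reasoning

    -- Move `x` one step towards `y`, to `x′`. By the triangle inequality, a neighbour of `y` that
    -- is farther than `y` from `x` is also farther than `y` from `x′`.
    b-step : ∀ {i} → suc i ≤ d → b (suc i) ≤ b i
    b-step {i} i<d with pair-at i<d
    ... | x , y , xy with first-step xy
    ...   | x′ , xx′ , x′y = begin
      b (suc i)                ≡⟨ nb-b xy ⟨
      nb (I (2 + i) x) y       ≤⟨ nb-mono y (λ z yz → 𝟙-mono (dist x z ≟ 2 + i) (dist x′ z ≟ suc i) λ xz →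
                                    ≤-antisym (subst (λ j → dist x′ z ≤ suc j) x′y (dist-stepʳ x′ yz))
                                              (s≤s⁻¹ (subst (_≤ suc (dist x′ z)) xz (dist-stepˡ z xx′)))) ⟩
      nb (I (suc i) x′) y      ≡⟨ nb-b x′y ⟩
      b i ∎
      where open ≤-Reasoning

    -- Dually, a neighbour of `y` that is nearer than `y` to `x′` is also nearer than `y` to `x`.
    c-step : ∀ {i} → suc i ≤ d → c i ≤ c (suc i)
    c-step {i} i<d with pair-at i<d
    ... | x , y , xy with first-step xy
    ...   | x′ , xx′ , x′y = begin
      c i             ≡⟨ nb-L x′y ⟨
      nb (L i x′) y   ≤⟨ nb-mono y (λ z yz → 𝟙-mono (suc (dist x′ z) ≟ i) (dist x z ≟ i) λ x′z →
                            ≤-antisym (subst (dist x z ≤_) x′z (dist-stepˡ z xx′))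
                                      (s≤s⁻¹ (subst (_≤ suc (dist x z)) xy (dist-stepʳ x (adj-sym X yz))))) ⟩
      nb (I i x) y    ≡⟨ nb-c xy ⟩
      c (suc i) ∎
      where open ≤-Reasoning

    b-antitone : ∀ {i j} → i ≤ j → j ≤ d → b j ≤ b i
    b-antitone i≤j j≤d with m≤n⇒m<n∨m≡n i≤j
    ... | inj₂ refl = ≤-refl
    b-antitone {j = suc j} i≤j j≤d | inj₁ i<j =
      ≤-trans (b-step j≤d) (b-antitone (s≤s⁻¹ i<j) (≤-trans (n≤1+n j) j≤d))

    c-monotone : ∀ {i j} → i ≤ j → j ≤ d → c i ≤ c j
    c-monotone i≤j j≤d with m≤n⇒m<n∨m≡n i≤j
    ... | inj₂ refl = ≤-refl
    c-monotone {j = suc j} i≤j j≤d | inj₁ i<j =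
      ≤-trans (c-monotone (s≤s⁻¹ i<j) (≤-trans (n≤1+n j) j≤d)) (c-step j≤d)

    K : Fin n → ℕ → ℕ
    K u i = sum (I i u)

    K₀≡1 : ∀ u → K u 0 ≡ 1
    K₀≡1 u = trans (sum-subset ⁅ u ⁆ (I 0 u)
        (λ v v∈ → 𝟙-yes (dist u v ≟ 0) (subst (λ v → dist u v ≡ 0) (sym (x∈⁅y⁆⇒x≡y u v∈)) (dist-refl u)))
        (λ v v∉ → 𝟙-no (dist u v ≟ 0) λ uv → v∉ (subst (λ v → v ∈ ⁅ u ⁆) (dist≡0 uv) (x∈⁅x⁆ u))))
      (∣⁅x⁆∣≡1 u)

    sum-guard : ∀ i u {q : Fin n → ℕ} {x} → (∀ {w} → dist u w ≡ i → q w ≡ x) →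
      sum (λ w → I i u w * q w) ≡ K u i * x
    sum-guard i u {x = x} q≡x = trans (sum-cong-≗ λ w → 𝟙-guard (dist u w ≟ i) q≡x)
      (sym (*-distribʳ-sum x (I i u)))

    -- Both sides count the edges between two consecutive spheres about `u`.
    K-step : ∀ u i → K u i * b i ≡ K u (suc i) * c (suc i)
    K-step u i = begin
      K u i * b i                                ≡⟨ sum-guard i u nb-b ⟨
      sum (λ w → I i u w * nb (I (suc i) u) w)   ≡⟨ nb-adjoint (I i u) (I (suc i) u) ⟩
      sum (λ w → I (suc i) u w * nb (I i u) w)   ≡⟨ sum-guard (suc i) u nb-c ⟩
      K u (suc i) * c (suc i) ∎
      where open ≡-Reasoning

    -- The recurrence `K-step` determines all sizes from the sphere of radius 0, because the
    -- `c (suc i)` are positive.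
    K-const : ∀ u v {i} → i ≤ d → K u i ≡ K v i
    K-const u v {zero}  _   = trans (K₀≡1 u) (sym (K₀≡1 v))
    K-const u v {suc i} i<d = *-cancelʳ-≡ _ _ (c (suc i)) {{>-nonZero (c-positive i<d)}} (begin
      K u (suc i) * c (suc i)   ≡⟨ K-step u i ⟨
      K u i * b i               ≡⟨ cong (_* b i) (K-const u v (≤-trans (n≤1+n i) i<d)) ⟩
      K v i * b i               ≡⟨ K-step v i ⟩
      K v (suc i) * c (suc i)   ∎)
      where open ≡-Reasoning

    K-positive : ∀ u {i} → i ≤ d → 1 ≤ K u i
    K-positive u {i} i≤d with pair-at i≤d
    ... | x , y , xy = begin
      1         ≡⟨ 𝟙-yes (dist x y ≟ i) xy ⟨
      I i x y   ≤⟨ term≤sum _ y ⟩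
      K x i     ≡⟨ K-const x u i≤d ⟩
      K u i     ∎
      where open ≤-Reasoning

    SphereSize⇒K : ∀ {v i m} → SphereSize X v i m → K v i ≡ m
    SphereSize⇒K {v} {i} size = sum-HasCard size _
      (λ w vw → 𝟙-yes (dist v w ≟ i) (Dist⇒≡ vw))
      (λ w ¬vw → 𝟙-no (dist v w ≟ i) (¬vw ∘ ≡⇒Dist))

    K-disjoint : ∀ u {i j} → i ≢ j → K u i + K u j ≤ n
    K-disjoint u {i} {j} i≢j = begin
      K u i + K u j                   ≡⟨ ∑-distrib-+ (I i u) (I j u) ⟨
      sum (λ w → I i u w + I j u w)   ≤⟨ sum-mono (λ w → exclusive (dist u w)) ⟩
      sum {n} (λ _ → 1)               ≡⟨ sum-const n 1 ⟩
      n * 1                           ≡⟨ *-identityʳ n ⟩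
      n                               ∎
      where
      open ≤-Reasoning
      exclusive : ∀ e → 𝟙 (e ≟ i) + 𝟙 (e ≟ j) ≤ 1
      exclusive e with e ≟ i | e ≟ j
      ... | yes refl | yes refl = contradiction refl i≢j
      ... | yes _    | no _     = ≤-refl
      ... | no _     | yes _    = ≤-refl
      ... | no _     | no _     = z≤n

    -- A random geodesic from y of length s is uniformly distributed on the
    -- sphere of radius s, and its m-th step (from distance m to m + 1) turns
    -- a good vertex into a bad one with probability at most β / b m.
    module _ {p} {Bad : Fin n → Set p} (bad? : ∀ w → Dec (Bad w)) {β : ℕ}
             (few-bad : ∀ w → ¬ Bad w → nb (𝟙 ∘ bad?) w ≤ β) where

      bad : Fin n → ℕ
      bad w = 𝟙 (bad? w)

      #bad : Fin n → ℕ → ℕ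
      #bad y m = sum (λ w → I m y w * bad w)

      -- Count the edges from the sphere of radius `m` to the bad vertices of the next one. Every
      -- such bad vertex receives `c (suc m)` of them; a bad inner vertex sends at most `b m`, a
      -- good one at most `β`.
      #bad-step : ∀ y m → c (suc m) * #bad y (suc m) ≤ b m * #bad y m + β * K y m
      #bad-step y m = begin
        c (suc m) * #bad y (suc m)                            ≡⟨ *-comm (c (suc m)) _ ⟩
        #bad y (suc m) * c (suc m)
          ≡⟨ *-distribʳ-sum (c (suc m)) (λ z → I (suc m) y z * bad z) ⟩
        sum (λ z → I (suc m) y z * bad z * c (suc m))         ≡⟨ sum-cong-≗ (λ z → lower z) ⟩
        sum (λ z → I (suc m) y z * bad z * nb (I m y) z)      ≡⟨ nb-adjoint (λ z → I (suc m) y z * bad z) (I m y) ⟩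
        sum (λ w → I m y w * nb (λ z → I (suc m) y z * bad z) w)
          ≤⟨ sum-mono (λ w → 𝟙-guard-≤ (dist y w ≟ m) (upper w)) ⟩
        sum (λ w → I m y w * (bad w * b m + β))
          ≡⟨ sum-cong-≗ (λ w → rearrange (I m y w) (bad w) (b m) β) ⟩
        sum (λ w → b m * (I m y w * bad w) + β * I m y w)
          ≡⟨ ∑-distrib-+ (λ w → b m * (I m y w * bad w)) (λ w → β * I m y w) ⟩
        sum (λ w → b m * (I m y w * bad w)) + sum (λ w → β * I m y w)
          ≡⟨ cong₂ _+_ (*-distribˡ-sum (b m) (λ w → I m y w * bad w)) (*-distribˡ-sum β (I m y)) ⟨
        b m * #bad y m + β * K y m ∎
        where
        open ≤-Reasoning
        rearrange : ∀ x y z t → x * (y * z + t) ≡ z * (x * y) + t * x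
        rearrange = solve-∀
        lower : ∀ z → I (suc m) y z * bad z * c (suc m) ≡ I (suc m) y z * bad z * nb (I m y) z
        lower z = trans (*-assoc (I (suc m) y z) (bad z) _)
          (trans (𝟙-guard (dist y z ≟ suc m) λ yz → cong (bad z *_) (sym (nb-c yz)))
                 (sym (*-assoc (I (suc m) y z) (bad z) _)))
        upper : ∀ w → dist y w ≡ m → nb (λ z → I (suc m) y z * bad z) w ≤ bad w * b m + β
        upper w yw with bad? w
        ... | yes _ = begin
          nb (λ z → I (suc m) y z * bad z) w
            ≤⟨ nb-mono w (λ z _ → ≤-trans (*-monoʳ-≤ (I (suc m) y z) (𝟙≤1 (bad? z))) (≤-reflexive (*-identityʳ _))) ⟩
          nb (I (suc m) y) w                  ≡⟨ nb-b yw ⟩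
          b m                                 ≡⟨ *-identityˡ (b m) ⟨
          1 * b m                             ≤⟨ m≤m+n _ β ⟩
          1 * b m + β                         ∎
        ... | no ¬bad-w = begin
          nb (λ z → I (suc m) y z * bad z) w
            ≤⟨ nb-mono w (λ z _ → ≤-trans (*-monoˡ-≤ (bad z) (𝟙≤1 (dist y z ≟ suc m))) (≤-reflexive (*-identityˡ _))) ⟩
          nb bad w                            ≤⟨ few-bad w ¬bad-w ⟩
          β                                   ∎

      -- Dividing `#bad-step` by `K-step`, the proportion of bad vertices grows by at most
      -- `β / b m`, hence by at most `β / B`, per step, starting from 0 at the good vertex `y`. The
      -- statement clears these denominators.
      #bad-bound : ∀ {y} → ¬ Bad y → ∀ {B} s → s ≤ d → (∀ m → m < s → B ≤ b m) →
        B * #bad y s ≤ s * (β * K y s)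
      #bad-bound {y} ¬bad-y {B} zero _ _ = ≤-reflexive (trans
        (cong (B *_) (trans (sum-cong-≗ none) (trans (sum-const n 0) (*-zeroʳ n))))
        (*-zeroʳ B))
        where
        none : ∀ w → I 0 y w * bad w ≡ 0
        none w = 𝟙-×-no (dist y w ≟ 0) (bad? w) λ (yw , bad-w) → ¬bad-y (subst Bad (sym (dist≡0 yw)) bad-w)
      #bad-bound {y} ¬bad-y {B} (suc s) s<d B≤b = *-cancelˡ-≤ (c (suc s)) {{>-nonZero (c-positive s<d)}} (begin
        c (suc s) * (B * #bad y (suc s))         ≡⟨ swap (c (suc s)) B (#bad y (suc s)) ⟩
        B * (c (suc s) * #bad y (suc s))         ≤⟨ *-monoʳ-≤ B (#bad-step y s) ⟩
        B * (b s * #bad y s + β * K y s)         ≡⟨ expand B (b s) (#bad y s) (β * K y s) ⟩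
        b s * (B * #bad y s) + B * (β * K y s)
          ≤⟨ +-mono-≤ (*-monoʳ-≤ (b s) (#bad-bound ¬bad-y s (≤-trans (n≤1+n s) s<d) (λ m m<s → B≤b m (m≤n⇒m≤1+n m<s))))
                                                             (*-monoˡ-≤ (β * K y s) (B≤b s ≤-refl)) ⟩
        b s * (s * (β * K y s)) + b s * (β * K y s) ≡⟨ collect (b s) s β (K y s) ⟩
        suc s * (β * (K y s * b s))              ≡⟨ cong (λ x → suc s * (β * x)) (K-step y s) ⟩
        suc s * (β * (K y (suc s) * c (suc s)))  ≡⟨ pull (suc s) β (K y (suc s)) (c (suc s)) ⟩
        c (suc s) * (suc s * (β * K y (suc s)))  ∎)
        where
        open ≤-Reasoning
        swap : ∀ x y z → x * (y * z) ≡ y * (x * z)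
        swap = solve-∀
        expand : ∀ x y z t → x * (y * z + t) ≡ y * (x * z) + x * t
        expand = solve-∀
        collect : ∀ x s y z → x * (s * (y * z)) + x * (y * z) ≡ suc s * (y * (z * x))
        collect = solve-∀
        pull : ∀ x y z t → x * (y * (z * t)) ≡ t * (x * (y * z))
        pull = solve-∀

  -- Growth below the dominant distance

  module Growth {n} (X : Graph n) (dist : Fin n → Fin n → ℕ)
    (dist-Dist : ∀ u v → Dist X u v (dist u v))
    {a b c : ℕ → ℕ} (array : IsIntersectionArray X a b c)
    {k : ℕ} (regular : Regular X k) {d : ℕ} (diameter : HasDiameter X d) where

    open Metric X dist dist-Dist
    open DistanceRegular X dist dist-Dist array regular diameter

    nb-none : ∀ {q : Fin n → ℕ} w → (∀ z → Adj X w z → q z ≡ 0) → nb q w ≡ 0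
    nb-none w q≡0 = trans (sum-cong-≗ λ z → trans (𝟙-guard (adj? X w z) (q≡0 z)) (*-zeroʳ (A w z)))
      (trans (sum-const n 0) (*-zeroʳ n))

    -- A vertex within distance `s` of `x` has neighbours beyond that only if it lies at distance
    -- exactly `s`; then there are `b s` of them.
    few-far : ∀ x s w → ¬ s < dist x w → nb (λ z → 𝟙 (s <? dist x z)) w ≤ b s
    few-far x s w ≮ with m≤n⇒m<n∨m≡n (≮⇒≥ ≮)
    ... | inj₁ xw<s = ≤-trans (≤-reflexive (nb-none w λ z wz → 𝟙-no (s <? dist x z)
            (≤⇒≯ (≤-trans (dist-stepʳ x wz) xw<s)))) z≤n
    ... | inj₂ xw≡s = ≤-trans (nb-mono w λ z wz → 𝟙-mono (s <? dist x z) (dist x z ≟ suc s) λ s<xz →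
            ≤-antisym (subst (λ e → dist x z ≤ suc e) xw≡s (dist-stepʳ x wz)) s<xz)
            (≤-reflexive (nb-b xw≡s))

    -- Likewise, only vertices at distance exactly `suc s` have neighbours within distance `s`.
    few-near : ∀ x s w → ¬ dist x w ≤ s → nb (λ z → 𝟙 (dist x z ≤? s)) w ≤ c (suc s)
    few-near x s w ≰ with m≤n⇒m<n∨m≡n (≰⇒> ≰)
    ... | inj₁ s<xw = ≤-trans (≤-reflexive (nb-none w λ z wz → 𝟙-no (dist x z ≤? s)
            (<⇒≱ (s≤s⁻¹ (≤-trans s<xw (dist-stepʳ x (adj-sym X wz))))))) z≤n
    ... | inj₂ eq = ≤-trans (nb-mono w λ z wz → 𝟙-mono (dist x z ≤? s) (dist x z ≟ s) λ xz≤s →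
            ≤-antisym xz≤s (s≤s⁻¹ (subst (_≤ suc (dist x z)) (sym eq) (dist-stepʳ x (adj-sym X wz)))))
            (≤-reflexive (nb-c (sym eq)))

    -- By `K-step` the quotient of consecutive sphere sizes is `b i / c (suc i)`; this and the next
    -- lemma translate between the two ratios.
    K-ratio⇒c-ratio : ∀ u {M i} → i ≤ d → M * K u i ≤ K u (suc i) → M * c (suc i) ≤ b i
    K-ratio⇒c-ratio u {M} {i} i≤d le = *-cancelˡ-≤ (K u i) {{>-nonZero (K-positive u i≤d)}} (begin
      K u i * (M * c (suc i))   ≡⟨ swap (K u i) M (c (suc i)) ⟩
      M * K u i * c (suc i)     ≤⟨ *-monoˡ-≤ (c (suc i)) le ⟩
      K u (suc i) * c (suc i)   ≡⟨ K-step u i ⟨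
      K u i * b i ∎)
      where
      open ≤-Reasoning
      swap : ∀ x y z → x * (y * z) ≡ y * x * z
      swap = solve-∀

    c-ratio⇒K-ratio : ∀ u {M i} → suc i ≤ d → M * c (suc i) ≤ b i → M * K u i ≤ K u (suc i)
    c-ratio⇒K-ratio u {M} {i} i<d le = *-cancelʳ-≤ (M * K u i) _ (c (suc i)) {{>-nonZero (c-positive i<d)}} (begin
      M * K u i * c (suc i)     ≡⟨ swap M (K u i) (c (suc i)) ⟩
      K u i * (M * c (suc i))   ≤⟨ *-monoʳ-≤ (K u i) le ⟩
      K u i * b i               ≡⟨ K-step u i ⟩
      K u (suc i) * c (suc i)   ∎)
      where
      open ≤-Reasoning
      swap : ∀ x y z → x * y * z ≡ y * (x * z)
      swap = solve-∀

    far near : Fin n → ℕ → Fin n → ℕ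
    far  x s w = 𝟙 (s <? dist x w)
    near x s w = 𝟙 (dist x w ≤? s)

    -- If `w` is not beyond distance `suc s` from `z`, then its distance from `z` is `s` or `suc s`,
    -- as `y` and `z` are adjacent. In the latter case `w` is either far from `x`, which the first
    -- term counts, or near it, which the last term counts.
    cover : ∀ x {y z} s w → Adj X z y →
      I (suc s) y w ≤ I (suc s) y w * far x (suc s) w + I (suc s) y w * far z (suc s) w
                      + I s z w + I (suc s) z w * near x (suc s) w
    cover x {y} {z} s w zy with dist y w ≟ suc s
    ... | no _ = z≤n
    ... | yes yw with suc s <? dist x w
    ...   | yes _ = s≤s z≤n
    ...   | no ≮x with suc s <? dist z w
    ...     | yes _ = s≤s z≤n
    ...     | no ≮z with m≤n⇒m<n∨m≡n (≮⇒≥ ≮z)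
    ...       | inj₂ zw≡1+s rewrite 𝟙-yes (dist z w ≟ suc s) zw≡1+s
                                  | 𝟙-yes (dist x w ≤? suc s) (≮⇒≥ ≮x) = m≤n+m 1 (𝟙 (dist z w ≟ s))
    ...       | inj₁ zw<1+s rewrite 𝟙-yes (dist z w ≟ s) (≤-antisym (s≤s⁻¹ zw<1+s)
                    (s≤s⁻¹ (subst (_≤ suc (dist z w)) yw (dist-stepˡ w (adj-sym X zy))))) = s≤s z≤n

    -- Let d(x,y) = suc s, d(y,z) = 1 and d(x,z) = suc s + 1.  Unless b (suc s) is
    -- large, a random geodesic of length suc s from y mostly stays
    -- within distance suc s of x and of z, while one from z mostly stays farther
    -- than that from x; yet both end essentially in the same sphere.
    b-drop : ∀ {s M} → 2 * (1 + d) ≤ M → 2 + s ≤ d → M * c (2 + s) ≤ b s → b s ≤ 4 * d * b (suc s)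
    b-drop {s} {M} 2+2d≤M s+2≤d Mc≤b with pair-at s+2≤d
    ... | x , z , xz with last-step xz
    ...   | y , xy , yz = *-cancelˡ-≤ (M * κ) {{>-nonZero (*-mono-≤ 1≤M (K-positive y s+1≤d))}}
            (+-cancelʳ-≤ (M * κ * B) _ _ total)
      where
      open ≤-Reasoning
      σ = suc s
      B = b s
      β = b σ
      κ = K y σ
      s+1≤d : σ ≤ d
      s+1≤d = ≤-trans (n≤1+n σ) s+2≤d
      s≤d : s ≤ d
      s≤d = ≤-trans (n≤1+n s) s+1≤d
      1≤M : 1 ≤ M
      1≤M = ≤-trans (s≤s z≤n) 2+2d≤M
      B≤b : ∀ m → m < σ → B ≤ b m
      B≤b m m<σ = b-antitone (s≤s⁻¹ m<σ) s≤d
      far-x far-z near-x : ℕ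
      far-x  = sum (λ w → I σ y w * far x σ w)
      far-z  = sum (λ w → I σ y w * far z σ w)
      near-x = sum (λ w → I σ z w * near x σ w)
      far-x≤ : B * far-x ≤ σ * (β * κ)
      far-x≤ = #bad-bound (λ w → σ <? dist x w) (few-far x σ) (≤⇒≯ (≤-reflexive xy)) σ s+1≤d B≤b
      far-z≤ : B * far-z ≤ σ * (β * κ)
      far-z≤ = #bad-bound (λ w → σ <? dist z w) (few-far z σ)
        (≤⇒≯ (subst (_≤ σ) (sym (dist-adj (adj-sym X yz))) (s≤s z≤n))) σ s+1≤d B≤b
      -- These geodesics start at `z`, whose distance from `x` is `suc σ`, so the start is not near;
      -- a step into the ball has at most `c (suc σ)` choices.
      near-x≤ : B * near-x ≤ σ * (c (suc σ) * κ)
      near-x≤ = subst (λ κ → B * near-x ≤ σ * (c (suc σ) * κ)) (K-const z y s+1≤d)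
        (#bad-bound (λ w → dist x w ≤? σ) (few-near x σ) (<⇒≱ (≤-reflexive (sym xz))) σ s+1≤d B≤b)
      -- The sphere of radius `s` about `z` is smaller than the next by a factor `M`, since
      -- `c (suc s)` is at most `c (2 + s)`.
      inner≤ : M * K z s ≤ κ
      inner≤ = subst (M * K z s ≤_) (K-const z y s+1≤d)
        (c-ratio⇒K-ratio z {M} s+1≤d (≤-trans (*-monoʳ-≤ M (c-step s+2≤d)) Mc≤b))
      κ≤ : κ ≤ far-x + far-z + K z s + near-x
      κ≤ = begin
        κ ≤⟨ sum-mono (λ w → cover x s w (adj-sym X yz)) ⟩
        sum (λ w → f₁ w + f₂ w + f₃ w + f₄ w)         ≡⟨ ∑-distrib-+ (λ w → f₁ w + f₂ w + f₃ w) f₄ ⟩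
        sum (λ w → f₁ w + f₂ w + f₃ w) + near-x       ≡⟨ cong (_+ near-x) (∑-distrib-+ (λ w → f₁ w + f₂ w) f₃) ⟩
        sum (λ w → f₁ w + f₂ w) + K z s + near-x      ≡⟨ cong (λ r → r + K z s + near-x) (∑-distrib-+ f₁ f₂) ⟩
        far-x + far-z + K z s + near-x ∎
        where
        f₁ f₂ f₃ f₄ : Fin n → ℕ
        f₁ w = I σ y w * far x σ w
        f₂ w = I σ y w * far z σ w
        f₃ w = I s z w
        f₄ w = I σ z w * near x σ w
      -- The two far terms give the main part. The inner sphere contributes one error `B * κ` and
      -- the near term `σ` more, both through the factor `M` in `Mc≤b`.
      Bκ≤ : M * (B * κ) ≤ M * (2 * (σ * (β * κ))) + (1 + σ) * (B * κ)
      Bκ≤ = begin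
        M * (B * κ)                                     ≤⟨ *-monoʳ-≤ M (*-monoʳ-≤ B κ≤) ⟩
        M * (B * (far-x + far-z + K z s + near-x))      ≡⟨ expand M B far-x far-z (K z s) near-x ⟩
        M * (B * far-x + B * far-z) + B * (M * K z s) + M * (B * near-x)
          ≤⟨ +-mono-≤ (+-mono-≤ (*-monoʳ-≤ M (+-mono-≤ far-x≤ far-z≤)) (*-monoʳ-≤ B inner≤)) (*-monoʳ-≤ M near-x≤) ⟩
        M * (σ * (β * κ) + σ * (β * κ)) + B * κ + M * (σ * (c (suc σ) * κ))
          ≡⟨ regroup M (σ * (β * κ)) (B * κ) σ (c (suc σ)) κ ⟩
        M * (2 * (σ * (β * κ))) + (B * κ + σ * (M * c (suc σ) * κ))
          ≤⟨ +-monoʳ-≤ (M * (2 * (σ * (β * κ)))) (+-monoʳ-≤ (B * κ) (*-monoʳ-≤ σ (*-monoˡ-≤ κ Mc≤b))) ⟩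
        M * (2 * (σ * (β * κ))) + (1 + σ) * (B * κ) ∎
        where
        expand : ∀ m b p q r t → m * (b * (p + q + r + t)) ≡ m * (b * p + b * q) + b * (m * r) + m * (b * t)
        expand = solve-∀
        regroup : ∀ m p q s c κ → m * (p + p) + q + m * (s * (c * κ)) ≡ m * (2 * p) + (q + s * (m * c * κ))
        regroup = solve-∀
      -- Since `M` is at least `2 * (1 + σ)`, the error is at most half of the left side of `Bκ≤`;
      -- doubling lets it be cancelled.
      total : M * κ * B + M * κ * B ≤ M * κ * (4 * d * β) + M * κ * B
      total = begin
        M * κ * B + M * κ * B                                           ≡⟨ double M κ B ⟩
        2 * (M * (B * κ))                                               ≤⟨ *-monoʳ-≤ 2 Bκ≤ ⟩
        2 * (M * (2 * (σ * (β * κ))) + (1 + σ) * (B * κ))               ≡⟨ spread M σ β κ B ⟩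
        M * κ * (4 * σ * β) + 2 * (1 + σ) * (B * κ)
          ≤⟨ +-mono-≤ (*-monoʳ-≤ (M * κ) (*-monoˡ-≤ β (*-monoʳ-≤ 4 s+1≤d)))
                      (*-monoˡ-≤ (B * κ) (≤-trans (*-monoʳ-≤ 2 (s≤s s+1≤d)) 2+2d≤M)) ⟩
        M * κ * (4 * d * β) + M * (B * κ)
          ≡⟨ cong (M * κ * (4 * d * β) +_) (reorder M B κ) ⟩
        M * κ * (4 * d * β) + M * κ * B ∎
        where
        double : ∀ m κ b → m * κ * b + m * κ * b ≡ 2 * (m * (b * κ))
        double = solve-∀
        spread : ∀ m s β κ b → 2 * (m * (2 * (s * (β * κ))) + (1 + s) * (b * κ)) ≡ m * κ * (4 * s * β) + 2 * (1 + s) * (b * κ)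
        spread = solve-∀
        reorder : ∀ m b κ → m * (b * κ) ≡ m * κ * b
        reorder = solve-∀

    -- Start from `b 0 = k` and lose a factor `4 * d` at each step by `b-drop`. Its hypothesis
    -- passes from `t` down to each smaller index because `c` increases and `b` decreases.
    b-large : ∀ {t M} → 2 * (1 + d) ≤ M → suc t ≤ d → M * c (suc t) ≤ b t → ∀ i → i ≤ t → k ≤ (4 * d) ^ i * b i
    b-large 2+2d≤M t<d Mc≤b zero _ = ≤-reflexive (sym (trans (+-identityʳ (b 0)) b₀≡k))
    b-large {t} {M} 2+2d≤M t<d Mc≤b (suc i) i<t = begin
      k                                   ≤⟨ b-large {M = M} 2+2d≤M t<d Mc≤b i (<⇒≤ i<t) ⟩
      (4 * d) ^ i * b i
        ≤⟨ *-monoʳ-≤ ((4 * d) ^ i) (b-drop {M = M} 2+2d≤M (≤-trans (s≤s i<t) t<d) Mc≤bᵢ) ⟩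
      (4 * d) ^ i * (4 * d * b (suc i))   ≡⟨ reorder ((4 * d) ^ i) (4 * d) (b (suc i)) ⟩
      (4 * d) ^ suc i * b (suc i)         ∎
      where
      open ≤-Reasoning
      reorder : ∀ x y z → x * (y * z) ≡ y * x * z
      reorder = solve-∀
      Mc≤bᵢ : M * c (2 + i) ≤ b i
      Mc≤bᵢ = ≤-trans (*-monoʳ-≤ M (c-monotone (s≤s i<t) t<d))
        (≤-trans Mc≤b (b-antitone (<⇒≤ i<t) (<⇒≤ t<d)))

-- Rational approximations of eigenvectors

module _ where

  open import Data.Rational.Base using (_+_; _*_; _-_; -_; _≤_; _<_; _/_; Positive; nonNegative; positive) renaming (∣_∣ to abs)
  open SemiringSum ℚR.semiring using (sum; sum-cong-≗; ∑-distrib-+; *-distribˡ-sum; *-distribʳ-sum)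

  ι : ℕ → ℚ
  ι m = ℤ.+ m / 1

  private
    ιᵘ : ℕ → ℚᵘ.ℚᵘ
    ιᵘ m = ℚᵘ.mkℚᵘ (ℤ.+ m) 0

  abstract
    ι-+ : ∀ m n → ι (m ℕ.+ n) ≡ ι m + ι n
    ι-+ m n = ℚ.toℚᵘ-injective (begin
      ℚ.toℚᵘ (ι (m ℕ.+ n))                ≈⟨ ℚ.toℚᵘ-fromℚᵘ (ιᵘ (m ℕ.+ n)) ⟩
      ιᵘ (m ℕ.+ n)
        ≈⟨ ℚᵘ.*≡* (cong (λ x → (x ℤ.* ℤ.+ 1)) (cong₂ ℤ._+_ (sym (ℤ.*-identityʳ (ℤ.+ m))) (sym (ℤ.*-identityʳ (ℤ.+ n))))) ⟩
      ιᵘ m ℚᵘ.+ ιᵘ n                      ≈⟨ ℚᵘ.+-cong (ℚ.toℚᵘ-fromℚᵘ (ιᵘ m)) (ℚ.toℚᵘ-fromℚᵘ (ιᵘ n)) ⟨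
      ℚ.toℚᵘ (ι m) ℚᵘ.+ ℚ.toℚᵘ (ι n)      ≈⟨ ℚ.toℚᵘ-homo-+ (ι m) (ι n) ⟨
      ℚ.toℚᵘ (ι m + ι n) ∎)
      where open ℚᵘ.≃-Reasoning

    ι-* : ∀ m n → ι (m ℕ.* n) ≡ ι m * ι n
    ι-* m n = ℚ.toℚᵘ-injective (begin
      ℚ.toℚᵘ (ι (m ℕ.* n))                ≈⟨ ℚ.toℚᵘ-fromℚᵘ (ιᵘ (m ℕ.* n)) ⟩
      ιᵘ (m ℕ.* n)                        ≈⟨ ℚᵘ.*≡* (cong (ℤ._* ℤ.+ 1) (ℤ.pos-* m n)) ⟩
      ιᵘ m ℚᵘ.* ιᵘ n                      ≈⟨ ℚᵘ.*-cong (ℚ.toℚᵘ-fromℚᵘ (ιᵘ m)) (ℚ.toℚᵘ-fromℚᵘ (ιᵘ n)) ⟨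
      ℚ.toℚᵘ (ι m) ℚᵘ.* ℚ.toℚᵘ (ι n)      ≈⟨ ℚ.toℚᵘ-homo-* (ι m) (ι n) ⟨
      ℚ.toℚᵘ (ι m * ι n) ∎)
      where open ℚᵘ.≃-Reasoning

    ι-mono : ∀ {m n} → m ℕ.≤ n → ι m ≤ ι n
    ι-mono {m} {n} m≤n = ℚ.toℚᵘ-cancel-≤ (begin
      ℚ.toℚᵘ (ι m)  ≃⟨ ℚ.toℚᵘ-fromℚᵘ (ιᵘ m) ⟩
      ιᵘ m          ≤⟨ ℚᵘ.*≤* (ℤ.*-monoʳ-≤-nonNeg (ℤ.+ 1) (ℤ.+≤+ m≤n)) ⟩
      ιᵘ n          ≃⟨ ℚ.toℚᵘ-fromℚᵘ (ιᵘ n) ⟨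
      ℚ.toℚᵘ (ι n)  ∎)
      where open ℚᵘ.≤-Reasoning

    ι-cancel-≤ : ∀ {m n} → ι m ≤ ι n → m ℕ.≤ n
    ι-cancel-≤ {m} {n} le = ℤ.drop‿+≤+ (subst₂ ℤ._≤_ (ℤ.*-identityʳ (ℤ.+ m)) (ℤ.*-identityʳ (ℤ.+ n)) (ℚᵘ.drop-*≤* (begin
      ιᵘ m          ≃⟨ ℚ.toℚᵘ-fromℚᵘ (ιᵘ m) ⟨
      ℚ.toℚᵘ (ι m)  ≤⟨ ℚ.toℚᵘ-mono-≤ le ⟩
      ℚ.toℚᵘ (ι n)  ≃⟨ ℚ.toℚᵘ-fromℚᵘ (ιᵘ n) ⟩
      ιᵘ n          ∎)))
      where open ℚᵘ.≤-Reasoning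

    0≤ι : ∀ m → 0ℚ ≤ ι m
    0≤ι m = ι-mono {0} {m} z≤n

    0<ι : ∀ {m} → 1 ℕ.≤ m → 0ℚ < ι m
    0<ι 1≤m = ℚ.<-≤-trans (ℚ.positive⁻¹ 1ℚ) (ι-mono 1≤m)

    ι-positive : ∀ {m} → 1 ℕ.≤ m → Positive (ι m)
    ι-positive 1≤m = positive (0<ι 1≤m)

    ι-sum : ∀ {n} (f : Fin n → ℕ) → ι (∑ℕ.sum f) ≡ sum (ι ∘ f)
    ι-sum {zero}  f = refl
    ι-sum {suc n} f = trans (ι-+ (f zero) _) (cong (_+_ (ι (f zero))) (ι-sum (f ∘ suc)))

  abstract
    -- The pattern for certificates: a ring identity writes the difference `q - p` as an expression
    -- `r` that is visibly nonnegative.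
    ≤-by : ∀ {p q r} → 0ℚ ≤ r → q - p ≡ r → p ≤ q
    ≤-by {p} {q} 0≤r eq = subst₂ _≤_ (ℚ.+-identityʳ p) (back p q)
      (ℚ.+-monoʳ-≤ p (subst (0ℚ ≤_) (sym eq) 0≤r))
      where
      open +-*-Solver
      back : ∀ p q → p + (q - p) ≡ q
      back = solve 2 (λ p q → p :+ (q :- p) := q) refl

    0≤-by : ∀ {p q} → p ≤ q → 0ℚ ≤ q - p
    0≤-by {p} {q} p≤q = subst (_≤ q - p) (ℚ.+-inverseʳ p) (ℚ.+-monoˡ-≤ (- p) p≤q)

    +≥0 : ∀ {p q} → 0ℚ ≤ p → 0ℚ ≤ q → 0ℚ ≤ p + q
    +≥0 0≤p 0≤q = ℚ.+-mono-≤ 0≤p 0≤q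

    *≥0 : ∀ {p q} → 0ℚ ≤ p → 0ℚ ≤ q → 0ℚ ≤ p * q
    *≥0 {p} {q} 0≤p 0≤q = subst (_≤ p * q) (ℚ.*-zeroʳ p) (ℚ.*-monoˡ-≤-nonNeg p {{nonNegative 0≤p}} 0≤q)

    *-monoʳ : ∀ {p q r} → 0ℚ ≤ p → q ≤ r → p * q ≤ p * r
    *-monoʳ {p} 0≤p = ℚ.*-monoˡ-≤-nonNeg p {{nonNegative 0≤p}}

    sum-mono-≤ : ∀ {n} {f g : Fin n → ℚ} → (∀ i → f i ≤ g i) → sum f ≤ sum g
    sum-mono-≤ {zero}  _   = ℚ.≤-refl
    sum-mono-≤ {suc n} f≤g = ℚ.+-mono-≤ (f≤g zero) (sum-mono-≤ (f≤g ∘ suc))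

    ∣sum∣≤ : ∀ {n} (f : Fin n → ℚ) → abs (sum f) ≤ sum (abs ∘ f)
    ∣sum∣≤ {zero}  f = ℚ.≤-refl
    ∣sum∣≤ {suc n} f = ℚ.≤-trans (ℚ.∣p+q∣≤∣p∣+∣q∣ (f zero) (sum (f ∘ suc)))
      (ℚ.+-monoʳ-≤ (abs (f zero)) (∣sum∣≤ (f ∘ suc)))

    ∣weighted-sum∣≤ : ∀ {n m} (p : Fin n → ℕ) (f : Fin n → ℚ) → (∀ w → abs (f w) ≤ m) →
      abs (sum (λ w → ι (p w) * f w)) ≤ ι (∑ℕ.sum p) * m
    ∣weighted-sum∣≤ {m = m} p f f≤m = begin
      abs (sum (λ w → ι (p w) * f w))        ≤⟨ ∣sum∣≤ (λ w → ι (p w) * f w) ⟩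
      sum (λ w → abs (ι (p w) * f w))        ≤⟨ sum-mono-≤ (λ w → begin
        abs (ι (p w) * f w)                    ≡⟨ ℚ.∣p*q∣≡∣p∣*∣q∣ (ι (p w)) (f w) ⟩
        abs (ι (p w)) * abs (f w)              ≡⟨ cong (_* abs (f w)) (ℚ.0≤p⇒∣p∣≡p (0≤ι (p w))) ⟩
        ι (p w) * abs (f w)                    ≤⟨ *-monoʳ (0≤ι (p w)) (f≤m w) ⟩
        ι (p w) * m                            ∎) ⟩
      sum (λ w → ι (p w) * m)                ≡⟨ *-distribʳ-sum m (ι ∘ p) ⟨
      sum (ι ∘ p) * m                        ≡⟨ cong (_* m) (ι-sum p) ⟨
      ι (∑ℕ.sum p) * m                       ∎
      where open ℚ.≤-Reasoning

    ι𝟙-guard : ∀ {p} {P : Set p} {x y} (P? : Dec P) → (P → x ≡ y) → ι (𝟙 P?) * x ≡ ι (𝟙 P?) * y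
    ι𝟙-guard (yes p) x≡y = cong (1ℚ *_) (x≡y p)
    ι𝟙-guard {x = x} {y} (no _) _ = trans (ℚ.*-zeroˡ x) (sym (ℚ.*-zeroˡ y))

  argmax : ∀ {n} → Fin n → (g : Fin n → ℚ) → ∃[ u ] (∀ w → g w ≤ g u)
  argmax {suc zero}    _ g = zero , λ { zero → ℚ.≤-refl }
  argmax {suc (suc n)} _ g with argmax zero (g ∘ suc)
  ... | u , u-max with ℚ.≤-total (g zero) (g (suc u))
  ...   | inj₁ g₀≤ = suc u , λ { zero → g₀≤ ; (suc w) → u-max w }
  ...   | inj₂ ≤g₀ = zero , λ { zero → ℚ.≤-refl ; (suc w) → ℚ.≤-trans (u-max w) ≤g₀ }

  abstract
    -- To be read with κ = kᵢ, m = max |f|, g = |Fᵢ| and h = cᵢ₊₁ |Fᵢ₊₁|, where Fᵢ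
    -- is the sum of f over the sphere of radius i about a maximum of |f|.
    deficit-step : ∀ {a b c κ m g h δ θ η P Δ} →
      0ℚ ≤ a → 0ℚ ≤ b → 0ℚ ≤ c → 0ℚ ≤ κ → 0ℚ ≤ g → 0ℚ ≤ δ → 0ℚ ≤ η → 0ℚ ≤ P →
      1ℚ ≤ a + b + c → g ≤ κ * m →
      θ * g ≤ c * κ * m + a * g + h + κ * δ →
      (a + b + c) * (1ℚ - η) ≤ θ →
      κ * m - g ≤ κ * P → η * m + δ ≤ P → a + b + c ≤ Δ * b →
      κ * b * m - h ≤ κ * b * (ι 2 * Δ * P)
    deficit-step {a} {b} {c} {κ} {m} {g} {h} {δ} {θ} {η} {P} {Δ}
      0≤a 0≤b 0≤c 0≤κ 0≤g 0≤δ 0≤η 0≤P 1≤k g≤ hθ hk hP hρ hΔ =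
      -- With `k = a + b + c`, the left side is at most `(b + c) * (κ * m - g) + k * η * g + κ *
      -- δ`. The first term is at most `k * κ * P`, the other two together at most `k * κ * (η * m +
      -- δ)` and so again `k * κ * P`; finally `k` is at most `Δ * b`. The summands are the slacks
      -- of these estimates.
      ≤-by (+≥0 (+≥0 (+≥0 (+≥0 (+≥0 (+≥0 (+≥0
          (0≤-by hθ)
          (*≥0 (0≤-by hk) 0≤g))
          (*≥0 (+≥0 0≤b 0≤c) (0≤-by hP)))
          (*≥0 0≤a (*≥0 0≤κ 0≤P)))
          (*≥0 (*≥0 0≤k 0≤η) (0≤-by g≤)))
          (*≥0 (0≤-by 1≤k) (*≥0 0≤κ 0≤δ)))
          (*≥0 (*≥0 0≤k 0≤κ) (0≤-by hρ)))
          (*≥0 (*≥0 (*≥0 (0≤ι 2) 0≤κ) 0≤P) (0≤-by hΔ)))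
        (solve 12 (λ a b c κ m g h δ θ η P Δ →
            κ :* b :* (con (ι 2) :* Δ :* P) :- (κ :* b :* m :- h) :=
            (c :* κ :* m :+ a :* g :+ h :+ κ :* δ :- θ :* g)
            :+ (θ :- (a :+ b :+ c) :* (con 1ℚ :- η)) :* g
            :+ (b :+ c) :* (κ :* P :- (κ :* m :- g))
            :+ a :* (κ :* P)
            :+ (a :+ b :+ c) :* η :* (κ :* m :- g)
            :+ (a :+ b :+ c :- con 1ℚ) :* (κ :* δ)
            :+ (a :+ b :+ c) :* κ :* (P :- (η :* m :+ δ))
            :+ con (ι 2) :* κ :* P :* (Δ :* b :- (a :+ b :+ c)))
          refl a b c κ m g h δ θ η P Δ)
      where
      open +-*-Solver
      0≤k : 0ℚ ≤ a + b + c
      0≤k = +≥0 (+≥0 0≤a 0≤b) 0≤c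

  -- Sphere sums of an approximate eigenvector

  module Spectral {n} (X : Graph n) (dist : Fin n → Fin n → ℕ)
    (dist-Dist : ∀ u v → Dist X u v (dist u v))
    {a b c : ℕ → ℕ} (array : IsIntersectionArray X a b c)
    {k : ℕ} (regular : Regular X k) {d : ℕ} (diameter : HasDiameter X d) where

    open Metric X dist dist-Dist
    open DistanceRegular X dist dist-Dist array regular diameter

    nbℚ : (Fin n → ℚ) → Fin n → ℚ
    nbℚ f w = sum (λ z → ι (A w z) * f z)

    nbℚ-ι : ∀ q w → nbℚ (ι ∘ q) w ≡ ι (nb q w)
    nbℚ-ι q w = sym (trans (ι-sum (λ z → A w z ℕ.* q z)) (sum-cong-≗ λ z → ι-* (A w z) (q z)))

    nbℚ-adjoint : ∀ p q → sum (λ w → p w * nbℚ q w) ≡ sum (λ w → q w * nbℚ p w)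
    nbℚ-adjoint = Adjoint.adjoint ℚR.commutativeSemiring (λ w z → ι (A w z)) (λ w z → cong ι (A-sym w z))

    nbℚ-+ : ∀ p q w → nbℚ (λ z → p z + q z) w ≡ nbℚ p w + nbℚ q w
    nbℚ-+ p q w = trans (sum-cong-≗ λ z → ℚ.*-distribˡ-+ (ι (A w z)) (p z) (q z))
      (∑-distrib-+ (λ z → ι (A w z) * p z) (λ z → ι (A w z) * q z))

    sphere-sum : Fin n → ℕ → (Fin n → ℚ) → ℚ
    sphere-sum u i f = sum (λ w → ι (I i u w) * f w)

    -- Adjointness moves the neighbour sum onto the indicator of the sphere of radius `i`, where it
    -- has the constant value `x` on the sphere of radius `j`.
    sphere-sum-nb : ∀ u {i j x} f → (∀ {w} → dist u w ≡ j → nb (I i u) w ≡ x) →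
      sphere-sum u i (nbℚ λ z → ι (I j u z) * f z) ≡ ι x * sphere-sum u j f
    sphere-sum-nb u {i} {j} {x} f nb≡x = begin
      sum (λ w → ι (I i u w) * nbℚ (λ z → ι (I j u z) * f z) w)
        ≡⟨ nbℚ-adjoint (ι ∘ I i u) (λ z → ι (I j u z) * f z) ⟩
      sum (λ w → ι (I j u w) * f w * nbℚ (ι ∘ I i u) w)           ≡⟨ sum-cong-≗ (λ w → pointwise w) ⟩
      sum (λ w → ι x * (ι (I j u w) * f w))                       ≡⟨ *-distribˡ-sum (ι x) (λ w → ι (I j u w) * f w) ⟨
      ι x * sphere-sum u j f ∎
      where
      open ≡-Reasoning
      pointwise : ∀ w → ι (I j u w) * f w * nbℚ (ι ∘ I i u) w ≡ ι x * (ι (I j u w) * f w)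
      pointwise w = begin
        ι (I j u w) * f w * nbℚ (ι ∘ I i u) w    ≡⟨ ℚ.*-assoc (ι (I j u w)) (f w) _ ⟩
        ι (I j u w) * (f w * nbℚ (ι ∘ I i u) w)
          ≡⟨ ι𝟙-guard (dist u w ℕ.≟ j) (λ uw → cong (f w *_) (trans (nbℚ-ι (I i u) w) (cong ι (nb≡x uw)))) ⟩
        ι (I j u w) * (f w * ι x)                ≡⟨ ℚ.*-assoc (ι (I j u w)) (f w) (ι x) ⟨
        ι (I j u w) * f w * ι x                  ≡⟨ ℚ.*-comm _ (ι x) ⟩
        ι x * (ι (I j u w) * f w) ∎

    sphere-sum-bound : ∀ u i f {m} → (∀ w → abs (f w) ≤ m) → abs (sphere-sum u i f) ≤ ι (K u i) * m
    sphere-sum-bound u i f = ∣weighted-sum∣≤ (I i u) f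

    sphere-sum-+ : ∀ u i f g → sphere-sum u i (λ w → f w + g w) ≡ sphere-sum u i f + sphere-sum u i g
    sphere-sum-+ u i f g = trans (sum-cong-≗ λ w → ℚ.*-distribˡ-+ (ι (I i u w)) (f w) (g w))
      (∑-distrib-+ (λ w → ι (I i u w) * f w) (λ w → ι (I i u w) * g w))

    -- For positive `i` this is `b (i - 1)` times the sum of `f` over the sphere of radius `i - 1`,
    -- and for `i = 0` it vanishes. Only an upper bound for it is needed, which allows a treatment
    -- without cases.
    inward : Fin n → ℕ → (Fin n → ℚ) → ℚ
    inward u i f = sphere-sum u i (nbℚ λ z → ι (L i u z) * f z)

    -- Every vertex of the sphere has `c i` inward edges, and each edge carries one value of `f`.
    inward-bound : ∀ u i f {m} → (∀ w → abs (f w) ≤ m) → abs (inward u i f) ≤ ι (c i) * ι (K u i) * m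
    inward-bound u i f {m} f≤m = begin
      abs (inward u i f)                                  ≡⟨ cong abs adj ⟩
      abs (sum (λ z → ι (p z) * f z))                     ≤⟨ ∣weighted-sum∣≤ p f f≤m ⟩
      ι (∑ℕ.sum p) * m
        ≡⟨ cong (λ x → ι x * m) (trans (nb-adjoint (L i u) (I i u)) (sum-guard i u nb-L)) ⟩
      ι (K u i ℕ.* c i) * m
        ≡⟨ cong (_* m) (trans (cong ι (ℕ.*-comm (K u i) (c i))) (ι-* (c i) (K u i))) ⟩
      ι (c i) * ι (K u i) * m ∎
      where
      open ℚ.≤-Reasoning
      p : Fin n → ℕ
      p z = L i u z ℕ.* nb (I i u) z
      rearrange : ∀ x y z → x * y * z ≡ x * z * y
      rearrange = solve 3 (λ x y z → x :* y :* z := x :* z :* y) refl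
        where open +-*-Solver
      adj : inward u i f ≡ sum (λ z → ι (p z) * f z)
      adj = trans (nbℚ-adjoint (ι ∘ I i u) (λ z → ι (L i u z) * f z)) (sum-cong-≗ λ z →
        trans (cong (ι (L i u z) * f z *_) (nbℚ-ι (I i u) z))
        (trans (rearrange (ι (L i u z)) (f z) (ι (nb (I i u) z)))
               (cong (_* f z) (sym (ι-* (L i u z) (nb (I i u) z))))))

    -- The three-term recurrence of distance-regular graphs: split the neighbours of each vertex of
    -- the sphere into `layers`, then evaluate the parts on the same and on the next sphere by
    -- adjointness.
    three-term : ∀ u i f → sphere-sum u i (nbℚ f) ≡
      inward u i f + ι (a i) * sphere-sum u i f + ι (c (suc i)) * sphere-sum u (suc i) f
    three-term u i f = begin
      sphere-sum u i (nbℚ f)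
        ≡⟨ sum-cong-≗ (λ w → ι𝟙-guard (dist u w ℕ.≟ i) (split w)) ⟩
      sphere-sum u i (λ w → nbℚ fL w + nbℚ fI w + nbℚ fJ w)
        ≡⟨ sphere-sum-+ u i (λ w → nbℚ fL w + nbℚ fI w) (nbℚ fJ) ⟩
      sphere-sum u i (λ w → nbℚ fL w + nbℚ fI w) + sphere-sum u i (nbℚ fJ)
        ≡⟨ cong₂ _+_ (sphere-sum-+ u i (nbℚ fL) (nbℚ fI)) (sphere-sum-nb u f nb-c) ⟩
      inward u i f + sphere-sum u i (nbℚ fI) + ι (c (suc i)) * sphere-sum u (suc i) f
        ≡⟨ cong (λ x → inward u i f + x + ι (c (suc i)) * sphere-sum u (suc i) f) (sphere-sum-nb u f nb-a) ⟩
      inward u i f + ι (a i) * sphere-sum u i f + ι (c (suc i)) * sphere-sum u (suc i) f ∎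
      where
      open ≡-Reasoning
      fL fI fJ : Fin n → ℚ
      fL z = ι (L i u z) * f z
      fI z = ι (I i u z) * f z
      fJ z = ι (I (suc i) u z) * f z
      distrib : ∀ x y z t → (x + y + z) * t ≡ x * t + y * t + z * t
      distrib = solve 4 (λ x y z t → (x :+ y :+ z) :* t := x :* t :+ y :* t :+ z :* t) refl
        where open +-*-Solver
      ι-+₃ : ∀ x y z → ι (x ℕ.+ y ℕ.+ z) ≡ ι x + ι y + ι z
      ι-+₃ x y z = trans (ι-+ (x ℕ.+ y) z) (cong (_+ ι z) (ι-+ x y))
      unit : ∀ {w} z → dist u w ≡ i → Adj X w z → f z ≡ fL z + fI z + fJ z
      unit z uw wz = begin
        f z                                                      ≡⟨ ℚ.*-identityˡ (f z) ⟨
        ι 1 * f z                                                ≡⟨ cong (λ x → ι x * f z) (layers uw wz) ⟨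
        ι (L i u z ℕ.+ I i u z ℕ.+ I (suc i) u z) * f z
          ≡⟨ cong (_* f z) (ι-+₃ (L i u z) (I i u z) (I (suc i) u z)) ⟩
        (ι (L i u z) + ι (I i u z) + ι (I (suc i) u z)) * f z
          ≡⟨ distrib (ι (L i u z)) (ι (I i u z)) (ι (I (suc i) u z)) (f z) ⟩
        fL z + fI z + fJ z ∎
      split : ∀ w → dist u w ≡ i → nbℚ f w ≡ nbℚ fL w + nbℚ fI w + nbℚ fJ w
      split w uw = begin
        nbℚ f w                                ≡⟨ sum-cong-≗ (λ z → ι𝟙-guard (adj? X w z) (unit z uw)) ⟩
        nbℚ (λ z → fL z + fI z + fJ z) w       ≡⟨ nbℚ-+ (λ z → fL z + fI z) fJ w ⟩
        nbℚ (λ z → fL z + fI z) w + nbℚ fJ w   ≡⟨ cong (_+ nbℚ fJ w) (nbℚ-+ fL fI w) ⟩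
        nbℚ fL w + nbℚ fI w + nbℚ fJ w ∎

    module Approx (f : Fin n → ℚ) (θ δ : ℚ) (residual : ∀ w → abs (nbℚ f w - θ * f w) ≤ δ)
                  (u : Fin n) (f≤fᵤ : ∀ w → abs (f w) ≤ abs (f u)) where

      m : ℚ
      m = abs (f u)

      F : ℕ → ℚ
      F i = sphere-sum u i f

      0≤m : 0ℚ ≤ m
      0≤m = ℚ.0≤∣p∣ (f u)

      0≤δ : 0ℚ ≤ δ
      0≤δ = ℚ.≤-trans (ℚ.0≤∣p∣ (nbℚ f u - θ * f u)) (residual u)

      ∣F₀∣ : abs (F 0) ≡ ι (K u 0) * m
      ∣F₀∣ = begin
        abs (F 0)
          ≡⟨ cong abs (sum-cong-≗ λ w → ι𝟙-guard (dist u w ℕ.≟ 0) λ uw → cong f (sym (dist≡0 uw))) ⟩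
        abs (sum (λ w → ι (I 0 u w) * f u)) ≡⟨ cong abs (*-distribʳ-sum (f u) (ι ∘ I 0 u)) ⟨
        abs (sum (ι ∘ I 0 u) * f u)         ≡⟨ cong (λ x → abs (x * f u)) (ι-sum (I 0 u)) ⟨
        abs (ι (K u 0) * f u)               ≡⟨ ℚ.∣p*q∣≡∣p∣*∣q∣ (ι (K u 0)) (f u) ⟩
        abs (ι (K u 0)) * m                 ≡⟨ cong (_* m) (ℚ.0≤p⇒∣p∣≡p (0≤ι (K u 0))) ⟩
        ι (K u 0) * m ∎
        where open ≡-Reasoning

      -- Write `θ * F i` as the sphere sum of `nbℚ f` minus that of the residuals, insert
      -- `three-term`, and take absolute values.
      three-term-≤ : ∀ i → abs θ * abs (F i) ≤
        ι (c i) * ι (K u i) * m + ι (a i) * abs (F i) + ι (c (suc i)) * abs (F (suc i)) + ι (K u i) * δ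
      three-term-≤ i = begin
        abs θ * abs (F i)                                ≡⟨ ℚ.∣p*q∣≡∣p∣*∣q∣ θ (F i) ⟨
        abs (θ * F i)                                    ≡⟨ cong abs decompose ⟩
        abs (R + p + q - e)                              ≤⟨ ℚ.∣p-q∣≤∣p∣+∣q∣ (R + p + q) e ⟩
        abs (R + p + q) + abs e                          ≤⟨ ℚ.+-monoˡ-≤ (abs e) (ℚ.∣p+q∣≤∣p∣+∣q∣ (R + p) q) ⟩
        abs (R + p) + abs q + abs e
          ≤⟨ ℚ.+-monoˡ-≤ (abs e) (ℚ.+-monoˡ-≤ (abs q) (ℚ.∣p+q∣≤∣p∣+∣q∣ R p)) ⟩
        abs R + abs p + abs q + abs e
          ≤⟨ ℚ.+-mono-≤ (ℚ.+-mono-≤ (ℚ.+-mono-≤ (inward-bound u i f f≤fᵤ) (ℚ.≤-reflexive (scale (a i) (F i))))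
                                    (ℚ.≤-reflexive (scale (c (suc i)) (F (suc i)))))
                        (sphere-sum-bound u i r residual) ⟩
        ι (c i) * ι (K u i) * m + ι (a i) * abs (F i) + ι (c (suc i)) * abs (F (suc i)) + ι (K u i) * δ ∎
        where
        open ℚ.≤-Reasoning
        R p q e : ℚ
        r : Fin n → ℚ
        r w = nbℚ f w - θ * f w
        R = inward u i f
        p = ι (a i) * F i
        q = ι (c (suc i)) * F (suc i)
        e = sphere-sum u i r
        scale : ∀ x y → abs (ι x * y) ≡ ι x * abs y
        scale x y = trans (ℚ.∣p*q∣≡∣p∣*∣q∣ (ι x) y) (cong (_* abs y) (ℚ.0≤p⇒∣p∣≡p (0≤ι x)))
        cancel : ∀ x y → y ≡ x - (x - y)
        cancel = solve 2 (λ x y → y := x :- (x :- y)) refl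
          where open +-*-Solver
        e≡ : e ≡ sphere-sum u i (nbℚ f) - θ * F i
        e≡ = begin-equality
          sphere-sum u i r
            ≡⟨ sphere-sum-+ u i (nbℚ f) (λ w → - (θ * f w)) ⟩
          sphere-sum u i (nbℚ f) + sphere-sum u i (λ w → - (θ * f w))
            ≡⟨ cong (sphere-sum u i (nbℚ f) +_) (sum-cong-≗ λ w → negate (ι (I i u w)) θ (f w)) ⟩
          sphere-sum u i (nbℚ f) + sum (λ w → - θ * (ι (I i u w) * f w))
            ≡⟨ cong (sphere-sum u i (nbℚ f) +_) (*-distribˡ-sum (- θ) (λ w → ι (I i u w) * f w)) ⟨
          sphere-sum u i (nbℚ f) + - θ * F i
            ≡⟨ cong (sphere-sum u i (nbℚ f) +_) (ℚ.neg-distribˡ-* θ (F i)) ⟨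
          sphere-sum u i (nbℚ f) - θ * F i ∎
          where
          negate : ∀ x y z → x * - (y * z) ≡ - y * (x * z)
          negate = solve 3 (λ x y z → x :* (:- (y :* z)) := (:- y) :* (x :* z)) refl
            where open +-*-Solver
        decompose : θ * F i ≡ R + p + q - e
        decompose = trans (cancel (sphere-sum u i (nbℚ f)) (θ * F i))
          (cong₂ _-_ (three-term u i f) (sym e≡))

      module _ {η : ℚ} (0≤η : 0ℚ ≤ η) (θ-large : ι k * (1ℚ - η) ≤ abs θ)
               {Δ : ℕ} (1≤Δ : 1 ℕ.≤ Δ) (1≤k : 1 ℕ.≤ k) where

        ρ : ℚ
        ρ = η * m + δ

        -- The deficit per vertex allowed on the sphere of radius `i`. In `ρ`, the part `η * m` pays
        -- for `abs θ` falling short of `k` and `δ` for the residual; each step costs a factor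
        -- `2 * Δ`.
        P : ℕ → ℚ
        P i = ι ((2 ℕ.* Δ) ℕ.^ i) * ρ

        0≤ρ : 0ℚ ≤ ρ
        0≤ρ = +≥0 (*≥0 0≤η 0≤m) 0≤δ

        *ρ-mono : ∀ {x y} → x ℕ.≤ y → ι x * ρ ≤ ι y * ρ
        *ρ-mono x≤y = ℚ.*-monoʳ-≤-nonNeg ρ {{nonNegative 0≤ρ}} (ι-mono x≤y)

        1≤2Δ : 1 ℕ.≤ 2 ℕ.* Δ
        1≤2Δ = ℕ.≤-trans 1≤Δ (ℕ.m≤n*m Δ 2)

        1≤[2Δ]^ : ∀ i → 1 ℕ.≤ (2 ℕ.* Δ) ℕ.^ i
        1≤[2Δ]^ i = ℕ.m^n>0 (2 ℕ.* Δ) {{ℕ.>-nonZero 1≤2Δ}} i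

        ρ≤P : ∀ i → ρ ≤ P i
        ρ≤P i = subst (_≤ P i) (ℚ.*-identityˡ ρ) (*ρ-mono (1≤[2Δ]^ i))

        deficit : ∀ {t} → t ℕ.≤ d → (∀ i → i ℕ.< t → k ℕ.≤ Δ ℕ.* b i) →
          ∀ i → i ℕ.≤ t → ι (K u i) * m - abs (F i) ≤ ι (K u i) * P i
        deficit _ _ zero _ = begin
          ι (K u 0) * m - abs (F 0)           ≡⟨ cong (λ x → ι (K u 0) * m - x) ∣F₀∣ ⟩
          ι (K u 0) * m - ι (K u 0) * m       ≡⟨ ℚ.+-inverseʳ (ι (K u 0) * m) ⟩
          0ℚ                                  ≤⟨ *≥0 (0≤ι (K u 0)) (ℚ.≤-trans 0≤ρ (ρ≤P 0)) ⟩
          ι (K u 0) * P 0 ∎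
          where open ℚ.≤-Reasoning
        -- Multiplying by `c (suc i)` turns the next sphere size into `K u i * b i`, the form that
        -- `deficit-step` bounds.
        deficit t≤d b-large (suc i) i<t = ℚ.*-cancelˡ-≤-pos (ι (c (suc i))) {{ι-positive (c-positive i<d)}} (begin
          ι (c (suc i)) * (ι (K u (suc i)) * m - abs (F (suc i)))
            ≡⟨ distrib (ι (c (suc i))) (ι (K u (suc i))) m (abs (F (suc i))) ⟩
          ι (K u (suc i)) * ι (c (suc i)) * m - h
            ≡⟨ cong (λ x → x * m - h) κ′c′ ⟨
          κ * ι (b i) * m - h
            ≤⟨ deficit-step {c = ι (c i)} {κ = κ} {m = m} {δ = δ} {η = η} {P = P i} {Δ = ι Δ}
                 (0≤ι (a i)) (0≤ι (b i)) (0≤ι (c i)) (0≤ι (K u i)) (ℚ.0≤∣p∣ (F i)) 0≤δ 0≤η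
                 (ℚ.≤-trans 0≤ρ (ρ≤P i))
                 (subst (1ℚ ≤_) (sym a+b+c≡k) (ι-mono 1≤k))
                 (sphere-sum-bound u i f f≤fᵤ) (three-term-≤ i)
                 (subst (λ x → x * (1ℚ - η) ≤ abs θ) (sym a+b+c≡k) θ-large)
                 (deficit t≤d b-large i (ℕ.<⇒≤ i<t)) (ρ≤P i)
                 (subst₂ _≤_ (sym a+b+c≡k) (ι-* Δ (b i)) (ι-mono (b-large i i<t))) ⟩
          κ * ι (b i) * (ι 2 * ι Δ * P i)
            ≡⟨ cong₂ _*_ κ′c′ P-suc ⟩
          ι (K u (suc i)) * ι (c (suc i)) * P (suc i)
            ≡⟨ reorder (ι (K u (suc i))) (ι (c (suc i))) (P (suc i)) ⟩
          ι (c (suc i)) * (ι (K u (suc i)) * P (suc i)) ∎)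
          where
          open ℚ.≤-Reasoning
          i<d : suc i ℕ.≤ d
          i<d = ℕ.≤-trans i<t t≤d
          κ h : ℚ
          κ = ι (K u i)
          h = ι (c (suc i)) * abs (F (suc i))
          κ′c′ : κ * ι (b i) ≡ ι (K u (suc i)) * ι (c (suc i))
          κ′c′ = trans (sym (ι-* (K u i) (b i))) (trans (cong ι (K-step u i)) (ι-* (K u (suc i)) (c (suc i))))
          a+b+c≡k : ι (a i) + ι (b i) + ι (c i) ≡ ι k
          a+b+c≡k = trans (cong (_+ ι (c i)) (sym (ι-+ (a i) (b i)))) (trans (sym (ι-+ (a i ℕ.+ b i) (c i)))
            (cong ι (trans (ℕ.+-comm (a i ℕ.+ b i) (c i)) (trans (sym (ℕ.+-assoc (c i) (a i) (b i))) (c+a+b≡k (ℕ.<⇒≤ i<d))))))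
          P-suc : ι 2 * ι Δ * P i ≡ P (suc i)
          P-suc = trans (cong (_* P i) (sym (ι-* 2 Δ))) (trans (sym (ℚ.*-assoc (ι (2 ℕ.* Δ)) _ ρ))
            (cong (_* ρ) (sym (ι-* (2 ℕ.* Δ) ((2 ℕ.* Δ) ℕ.^ i)))))
          distrib : ∀ x y z t → x * (y * z - t) ≡ y * x * z - x * t
          distrib = solve 4 (λ x y z t → x :* (y :* z :- t) := y :* x :* z :- x :* t) refl
            where open +-*-Solver
          reorder : ∀ x y z → x * y * z ≡ y * (x * z)
          reorder = solve 3 (λ x y z → x :* y :* z := y :* (x :* z)) refl
            where open +-*-Solver

      -- As the total is zero, `F i` is minus the sum over the complement of the sphere, which has
      -- at most a quarter as many vertices as the sphere.
      off-sphere : ∀ i → sum f ≡ 0ℚ → 4 ℕ.* n ℕ.≤ 5 ℕ.* K u i → ι 4 * abs (F i) ≤ ι (K u i) * m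
      off-sphere i sum≡0 dominant = begin
        ι 4 * abs (F i)           ≡⟨ cong (λ x → ι 4 * abs x) F≡-G ⟩
        ι 4 * abs (- G)           ≡⟨ cong (ι 4 *_) (ℚ.∣-p∣≡∣p∣ G) ⟩
        ι 4 * abs G               ≤⟨ *-monoʳ (0≤ι 4) (∣weighted-sum∣≤ J f f≤fᵤ) ⟩
        ι 4 * (ι (∑ℕ.sum J) * m)  ≡⟨ ℚ.*-assoc (ι 4) (ι (∑ℕ.sum J)) m ⟨
        ι 4 * ι (∑ℕ.sum J) * m    ≡⟨ cong (_* m) (ι-* 4 (∑ℕ.sum J)) ⟨
        ι (4 ℕ.* ∑ℕ.sum J) * m    ≤⟨ ℚ.*-monoʳ-≤-nonNeg m {{nonNegative 0≤m}} (ι-mono 4J≤K) ⟩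
        ι (K u i) * m             ∎
        where
        open ℚ.≤-Reasoning
        J : Fin n → ℕ
        J w = 1 ℕ.∸ I i u w
        G : ℚ
        G = sum (λ w → ι (J w) * f w)
        I+J : ∀ w → I i u w ℕ.+ J w ≡ 1
        I+J w = ℕ.m+[n∸m]≡n (𝟙≤1 (dist u w ℕ.≟ i))
        K+J≡n : K u i ℕ.+ ∑ℕ.sum J ≡ n
        K+J≡n = trans (sym (∑ℕ.∑-distrib-+ (I i u) J))
          (trans (∑ℕ.sum-cong-≗ I+J) (trans (sum-const n 1) (ℕ.*-identityʳ n)))
        4J≤K : 4 ℕ.* ∑ℕ.sum J ℕ.≤ K u i
        4J≤K = ℕ.+-cancelˡ-≤ (4 ℕ.* K u i) _ _ (ℕ.≤-trans
          (ℕ.≤-reflexive (trans (sym (ℕ.*-distribˡ-+ 4 (K u i) (∑ℕ.sum J))) (cong (4 ℕ.*_) K+J≡n)))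
          (ℕ.≤-trans dominant (ℕ.≤-reflexive (ℕ.+-comm (K u i) (4 ℕ.* K u i)))))
        F+G≡0 : F i + G ≡ 0ℚ
        F+G≡0 = begin-equality
          F i + G
            ≡⟨ ∑-distrib-+ (λ w → ι (I i u w) * f w) (λ w → ι (J w) * f w) ⟨
          sum (λ w → ι (I i u w) * f w + ι (J w) * f w)
            ≡⟨ sum-cong-≗ (λ w → trans (sym (ℚ.*-distribʳ-+ (f w) (ι (I i u w)) (ι (J w))))
              (trans (cong (_* f w) (trans (sym (ι-+ (I i u w) (J w))) (cong ι (I+J w)))) (ℚ.*-identityˡ (f w)))) ⟩
          sum f                                             ≡⟨ sum≡0 ⟩
          0ℚ ∎
        F≡-G : F i ≡ - G
        F≡-G = begin-equality
          F i             ≡⟨ back (F i) G ⟩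
          F i + G + - G   ≡⟨ cong (_+ - G) F+G≡0 ⟩
          0ℚ + - G        ≡⟨ ℚ.+-identityˡ (- G) ⟩
          - G ∎
          where
          back : ∀ x y → x ≡ x + y + - y
          back = solve 2 (λ x y → x := x :+ y :+ :- y) refl
            where open +-*-Solver

      -- Write `g` for `abs (F t)`, `κ` for the size of the sphere and `Q` for the power of `2 * Δ`.
      -- Then `4 * κ * m` is at most `4 * g + 4 * κ * Q * (η * m + δ)`. Here `4 * g` is at most
      -- `κ * m` by `off-sphere`, and the part with `η` is at most `2 * κ * m` by the smallness of
      -- `η`, which leaves `κ * m` against `4 * κ * Q * δ`.
      max-bound : ∀ {η Δ t} → 0ℚ ≤ η → ι k * (1ℚ - η) ≤ abs θ → 1 ℕ.≤ Δ → 1 ℕ.≤ k →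
        t ℕ.≤ d → (∀ i → i ℕ.< t → k ℕ.≤ Δ ℕ.* b i) →
        sum f ≡ 0ℚ → 4 ℕ.* n ℕ.≤ 5 ℕ.* K u t →
        ι 2 * (ι ((2 ℕ.* Δ) ℕ.^ t) * η) ≤ 1ℚ → m ≤ ι 4 * ι ((2 ℕ.* Δ) ℕ.^ t) * δ
      max-bound {η} {Δ} {t} 0≤η θ-large 1≤Δ 1≤k t≤d b-large sum≡0 dominant small =
        ℚ.*-cancelˡ-≤-pos κ {{ι-positive (K-positive u t≤d)}}
          (≤-by (+≥0 (+≥0 (*≥0 (0≤ι 4) (0≤-by (deficit 0≤η θ-large 1≤Δ 1≤k t≤d b-large t ℕ.≤-refl)))
                          (0≤-by (off-sphere t sum≡0 dominant)))
                     (*≥0 (*≥0 (0≤ι 2) (*≥0 (0≤ι (K u t)) 0≤m)) (0≤-by small)))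
                (solve 6 (λ κ m g Q η δ →
                    κ :* (con (ι 4) :* Q :* δ) :- κ :* m :=
                    con (ι 4) :* (κ :* (Q :* (η :* m :+ δ)) :- (κ :* m :- g))
                    :+ (κ :* m :- con (ι 4) :* g)
                    :+ con (ι 2) :* (κ :* m) :* (con 1ℚ :- con (ι 2) :* (Q :* η)))
                  refl κ m (abs (F t)) (ι ((2 ℕ.* Δ) ℕ.^ t)) η δ))
        where
        open +-*-Solver
        κ : ℚ
        κ = ι (K u t)

  -- Null sequences

  -- Convergence to 0 for bare rational sequences, so that they can be combined without carrying
  -- Cauchy proofs.
  Null : (ℕ → ℚ) → Set
  Null s = ∀ ε → 0ℚ < ε → ∃[ N ] (∀ m → N ℕ.≤ m → abs (s m) ≤ ε)

  reciprocal : ∀ {p} → 0ℚ < p → ∃[ q ] (0ℚ < q × p * q ≡ 1ℚ)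
  reciprocal {p} 0<p = q , ℚ.positive⁻¹ q {{ℚ.1/pos⇒pos p {{p⁺}}}} , ℚ.*-inverseʳ p {{p≢0}}
    where
    p⁺ : Positive p
    p⁺ = positive 0<p
    p≢0 : ℚ.NonZero p
    p≢0 = ℚ.pos⇒nonZero p {{p⁺}}
    q : ℚ
    q = (ℚ.1/ p) {{p≢0}}

  abstract
    *>0 : ∀ {p q} → 0ℚ < p → 0ℚ < q → 0ℚ < p * q
    *>0 {p} {q} 0<p 0<q = ℚ.positive⁻¹ (p * q) {{ℚ.pos*pos⇒pos p {{positive 0<p}} q {{positive 0<q}}}}

    shrink : ∀ {C} → 0ℚ ≤ C → ∀ {ε} → 0ℚ < ε → ∃[ δ ] (0ℚ < δ × C * δ ≤ ε)
    shrink {C} 0≤C {ε} 0<ε with reciprocal {1ℚ + C} (ℚ.+-mono-<-≤ (ℚ.positive⁻¹ 1ℚ) 0≤C)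
    ... | r , 0<r , eq = r * ε , *>0 0<r 0<ε , (begin
      C * (r * ε)          ≤⟨ ≤-by (ℚ.<⇒≤ (*>0 0<r 0<ε)) (extra C (r * ε)) ⟩
      (1ℚ + C) * (r * ε)   ≡⟨ ℚ.*-assoc (1ℚ + C) r ε ⟨
      (1ℚ + C) * r * ε     ≡⟨ cong (_* ε) eq ⟩
      1ℚ * ε               ≡⟨ ℚ.*-identityˡ ε ⟩
      ε ∎)
      where
      open ℚ.≤-Reasoning
      extra : ∀ x y → (1ℚ + x) * y - x * y ≡ y
      extra = solve 2 (λ x y → (con 1ℚ :+ x) :* y :- x :* y := y) refl
        where open +-*-Solver

    half+half : ∀ ε → ½ * ε + ½ * ε ≡ ε
    half+half ε = trans (sym (ℚ.*-distribʳ-+ ε ½ ½)) (ℚ.*-identityˡ ε)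

    half>0 : ∀ {ε} → 0ℚ < ε → 0ℚ < ½ * ε
    half>0 = *>0 (ℚ.positive⁻¹ ½)

    ∣p∣≤∣q∣+∣p-q∣ : ∀ p q → abs p ≤ abs q + abs (p - q)
    ∣p∣≤∣q∣+∣p-q∣ p q = subst (λ r → abs r ≤ abs q + abs (p - q)) (back p q) (ℚ.∣p+q∣≤∣p∣+∣q∣ q (p - q))
      where
      back : ∀ p q → q + (p - q) ≡ p
      back = solve 2 (λ p q → q :+ (p :- q) := p) refl
        where open +-*-Solver

    Null-cong : ∀ {s t} → (∀ m → s m ≡ t m) → Null s → Null t
    Null-cong s≗t s₀ ε 0<ε with s₀ ε 0<ε
    ... | N , h = N , λ m N≤m → subst (λ x → abs x ≤ ε) (s≗t m) (h m N≤m)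

    Null-dominated : ∀ {s t} → (∀ m → abs (t m) ≤ abs (s m)) → Null s → Null t
    Null-dominated t≤s s₀ ε 0<ε with s₀ ε 0<ε
    ... | N , h = N , λ m N≤m → ℚ.≤-trans (t≤s m) (h m N≤m)

    Null-+ : ∀ {s t} → Null s → Null t → Null (λ m → s m + t m)
    Null-+ {s} {t} s₀ t₀ ε 0<ε with s₀ (½ * ε) (half>0 0<ε) | t₀ (½ * ε) (half>0 0<ε)
    ... | M , p | N , q = M ℕ.⊔ N , λ m le → begin
      abs (s m + t m)        ≤⟨ ℚ.∣p+q∣≤∣p∣+∣q∣ (s m) (t m) ⟩
      abs (s m) + abs (t m)  ≤⟨ ℚ.+-mono-≤ (p m (ℕ.m⊔n≤o⇒m≤o M N le)) (q m (ℕ.m⊔n≤o⇒n≤o M N le)) ⟩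
      ½ * ε + ½ * ε          ≡⟨ half+half ε ⟩
      ε ∎
      where open ℚ.≤-Reasoning

    Null-neg : ∀ {s} → Null s → Null (λ m → - s m)
    Null-neg {s} = Null-dominated {s} λ m → ℚ.≤-reflexive (ℚ.∣-p∣≡∣p∣ (s m))

    -- From some index `M` on, a Cauchy sequence is bounded by `abs (s M) + 1ℚ`.
    Null-* : ∀ {s t} → IsCauchy s → Null t → Null (λ m → s m * t m)
    Null-* {s} {t} s-cauchy t₀ ε 0<ε =
      let M , p = s-cauchy 1ℚ (ℚ.positive⁻¹ 1ℚ)
          δ , 0<δ , Cδ≤ε = shrink {abs (s M) + 1ℚ} (+≥0 (ℚ.0≤∣p∣ (s M)) (ℚ.nonNegative⁻¹ 1ℚ)) 0<ε
          N , q = t₀ δ 0<δ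
      in M ℕ.⊔ N , λ m le → begin
        abs (s m * t m)          ≡⟨ ℚ.∣p*q∣≡∣p∣*∣q∣ (s m) (t m) ⟩
        abs (s m) * abs (t m)    ≤⟨ *-monoʳ (ℚ.0≤∣p∣ (s m)) (q m (ℕ.m⊔n≤o⇒n≤o M N le)) ⟩
        abs (s m) * δ            ≤⟨ ℚ.*-monoʳ-≤-nonNeg δ {{nonNegative (ℚ.<⇒≤ 0<δ)}}
                                      (ℚ.≤-trans (∣p∣≤∣q∣+∣p-q∣ (s m) (s M))
                                        (ℚ.+-monoʳ-≤ (abs (s M)) (p m M (ℕ.m⊔n≤o⇒m≤o M N le) ℕ.≤-refl))) ⟩
        (abs (s M) + 1ℚ) * δ     ≤⟨ Cδ≤ε ⟩
        ε ∎
      where open ℚ.≤-Reasoning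

    Null-uniform : ∀ {n} (r : Fin n → ℕ → ℚ) → (∀ w → Null (r w)) →
      ∀ ε → 0ℚ < ε → ∃[ N ] (∀ m → N ℕ.≤ m → ∀ w → abs (r w m) ≤ ε)
    Null-uniform {zero}  r r₀ ε 0<ε = 0 , λ _ _ ()
    Null-uniform {suc n} r r₀ ε 0<ε with r₀ zero ε 0<ε | Null-uniform (r ∘ suc) (r₀ ∘ suc) ε 0<ε
    ... | M , p | N , q = M ℕ.⊔ N , λ where
      m le zero    → p m (ℕ.m⊔n≤o⇒m≤o M N le)
      m le (suc w) → q m (ℕ.m⊔n≤o⇒n≤o M N le) w

    Null-ι-cancel : ∀ {k s} → 1 ℕ.≤ k → Null (λ m → ι k * s m) → Null s
    Null-ι-cancel {k} {s} 1≤k = Null-dominated λ m → begin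
      abs (s m)               ≡⟨ ℚ.*-identityˡ (abs (s m)) ⟨
      1ℚ * abs (s m)          ≤⟨ ℚ.*-monoʳ-≤-nonNeg (abs (s m)) {{ℚ.∣-∣-nonNeg (s m)}} (ι-mono 1≤k) ⟩
      ι k * abs (s m)         ≡⟨ cong (_* abs (s m)) (ℚ.0≤p⇒∣p∣≡p (0≤ι k)) ⟨
      abs (ι k) * abs (s m)   ≡⟨ ℚ.∣p*q∣≡∣p∣*∣q∣ (ι k) (s m) ⟨
      abs (ι k * s m) ∎
      where open ℚ.≤-Reasoning

    ¬Null-1 : ¬ Null (λ _ → 1ℚ)
    ¬Null-1 null with null ½ (ℚ.positive⁻¹ ½)
    ... | N , h = ℚ.<-irrefl refl (ℚ.<-≤-trans (from-yes (½ ℚ.<? 1ℚ)) (h N ℕ.≤-refl))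

  -- Real linear independence in terms of rational sequences

  p-0≡p : ∀ p → p - 0ℚ ≡ p
  p-0≡p p = ℚ.+-identityʳ p

  ≈0⇒Null : ∀ {x} → x ≈ℝ 0ℝ → Null (seq x)
  ≈0⇒Null {x} x≈0 = Null-cong (λ m → p-0≡p (seq x m)) (_≈ℝ_.approx x≈0)

  Null⇒≈0 : ∀ {x} → Null (seq x) → x ≈ℝ 0ℝ
  Null⇒≈0 {x} x₀ = mk≈ (Null-cong (λ m → sym (p-0≡p (seq x m))) x₀)

  seq-sumℝ : ∀ {n} (x : Fin n → ℝ) m → seq (sumℝ x) m ≡ sum (λ i → seq (x i) m)
  seq-sumℝ {zero}  x m = refl
  seq-sumℝ {suc n} x m = cong (seq (x zero) m +_) (seq-sumℝ (x ∘ suc) m)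

  sum-pick : ∀ {n} (o : Fin n) (g : Fin n → ℚ) → sum (λ j → ι (𝟙 (j Fin.≟ o)) * g j) ≡ g o
  sum-pick o g = begin
    sum (λ j → ι (𝟙 (j Fin.≟ o)) * g j)   ≡⟨ sum-cong-≗ (λ j → ι𝟙-guard (j Fin.≟ o) (cong g)) ⟩
    sum (λ j → ι (𝟙 (j Fin.≟ o)) * g o)   ≡⟨ *-distribʳ-sum (g o) (λ j → ι (𝟙 (j Fin.≟ o))) ⟨
    sum (λ j → ι (𝟙 (j Fin.≟ o))) * g o   ≡⟨ cong (_* g o) (ι-sum (λ j → 𝟙 (j Fin.≟ o))) ⟨
    ι (∑ℕ.sum (λ j → 𝟙 (j Fin.≟ o))) * g o ≡⟨ cong (λ x → ι x * g o) one ⟩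
    1ℚ * g o                              ≡⟨ ℚ.*-identityˡ (g o) ⟩
    g o ∎
    where
    open ≡-Reasoning
    one : ∑ℕ.sum (λ j → 𝟙 (j Fin.≟ o)) ≡ 1
    one = trans (sum-subset ⁅ o ⁆ _ (λ j j∈ → 𝟙-yes (j Fin.≟ o) (x∈⁅y⁆⇒x≡y o j∈))
                                    (λ j j∉ → 𝟙-no (j Fin.≟ o) λ { refl → j∉ (x∈⁅x⁆ o) }))
                (∣⁅x⁆∣≡1 o)

  -- Apply independence to the coefficients `α` at `o`, `β` at `i` and 0 elsewhere; since `o` and
  -- `i` differ, both can be read off again.
  independent-pair : ∀ {m n} {x : Fin m → Fin n → ℝ} → LinearlyIndependent x → ∀ {o i} → o ≢ i → (α β : ℝ) →
    (∀ u → Null (λ l → seq α l * seq (x o u) l + seq β l * seq (x i u) l)) → Null (seq α) × Null (seq β)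
  independent-pair {x = x} indep {o} {i} o≢i α β null =
      Null-cong (λ l → at-o (seq α l) (seq β l)) (coeff₀ o)
    , Null-cong (λ l → at-i (seq α l) (seq β l)) (coeff₀ i)
    where
    e : ∀ j l → ℚ
    e j l = ι (𝟙 (j Fin.≟ l))
    coeff : ∀ j → ℝ
    coeff j = fromℚ (e j o) *ℝ α +ℝ fromℚ (e j i) *ℝ β
    coeff₀ : ∀ j → Null (seq (coeff j))
    coeff₀ j = ≈0⇒Null (indep coeff (λ u → Null⇒≈0 (Null-cong (λ l → sym (combination u l)) (null u))) j)
      where
      open ≡-Reasoning
      distrib : ∀ p a q b y → (p * a + q * b) * y ≡ p * (a * y) + q * (b * y)
      distrib = solve 5 (λ p a q b y → (p :* a :+ q :* b) :* y := p :* (a :* y) :+ q :* (b :* y)) refl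
        where open +-*-Solver
      combination : ∀ u l → seq (sumℝ (λ j → coeff j *ℝ x j u)) l ≡ seq α l * seq (x o u) l + seq β l * seq (x i u) l
      combination u l = begin
        seq (sumℝ (λ j → coeff j *ℝ x j u)) l
          ≡⟨ seq-sumℝ (λ j → coeff j *ℝ x j u) l ⟩
        sum (λ j → (e j o * seq α l + e j i * seq β l) * seq (x j u) l)
          ≡⟨ sum-cong-≗ (λ j → distrib (e j o) (seq α l) (e j i) (seq β l) (seq (x j u) l)) ⟩
        sum (λ j → e j o * (seq α l * seq (x j u) l) + e j i * (seq β l * seq (x j u) l))
          ≡⟨ ∑-distrib-+ (λ j → e j o * (seq α l * seq (x j u) l)) (λ j → e j i * (seq β l * seq (x j u) l)) ⟩
        sum (λ j → e j o * (seq α l * seq (x j u) l)) + sum (λ j → e j i * (seq β l * seq (x j u) l))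
          ≡⟨ cong₂ _+_ (sum-pick o (λ j → seq α l * seq (x j u) l)) (sum-pick i (λ j → seq β l * seq (x j u) l)) ⟩
        seq α l * seq (x o u) l + seq β l * seq (x i u) l ∎
    1a+0b : ∀ a b → 1ℚ * a + 0ℚ * b ≡ a
    1a+0b = solve 2 (λ a b → con 1ℚ :* a :+ con 0ℚ :* b := a) refl
      where open +-*-Solver
    0a+1b : ∀ a b → 0ℚ * a + 1ℚ * b ≡ b
    0a+1b = solve 2 (λ a b → con 0ℚ :* a :+ con 1ℚ :* b := b) refl
      where open +-*-Solver
    at-o : ∀ a b → e o o * a + e o i * b ≡ a
    at-o a b = trans
      (cong₂ (λ p q → p * a + q * b) (cong ι (𝟙-yes (o Fin.≟ o) refl)) (cong ι (𝟙-no (o Fin.≟ i) o≢i)))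
      (1a+0b a b)
    at-i : ∀ a b → e i o * a + e i i * b ≡ b
    at-i a b = trans
      (cong₂ (λ p q → p * a + q * b) (cong ι (𝟙-no (i Fin.≟ o) (o≢i ∘ sym))) (cong ι (𝟙-yes (i Fin.≟ i) refl)))
      (0a+1b a b)

  -- This is `n` times the deviation from the mean, free of division; it tends to 0 at every `w`
  -- exactly when the real vector `x` is constant.
  centred : ∀ {n} → (Fin n → ℝ) → Fin n → ℕ → ℚ
  centred {n} x w l = ι n * seq (x w) l - sum (λ v → seq (x v) l)

  -- Let `Sₒ` and `Sᵢ` be the sums of the two vectors. If both are constant, the combination with
  -- coefficients `- Sᵢ` and `Sₒ` vanishes, so `Sᵢ` is 0. Then the vector at `i` is itself 0, and
  -- the coefficients 0 and 1 contradict independence. No case distinction on real numbers is made.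
  not-both-constant : ∀ {m n} {x : Fin m → Fin n → ℝ} → LinearlyIndependent x → ∀ {o i} → o ≢ i → 1 ℕ.≤ n →
    (∀ w → Null (centred (x o) w)) → (∀ w → Null (centred (x i) w)) → ⊥
  not-both-constant {n = n} {x} indep {o} {i} o≢i 1≤n fₒ fᵢ =
    ¬Null-1 (proj₂ (independent-pair indep o≢i 0ℝ 1ℝ λ w →
      Null-ι-cancel 1≤n (Null-cong (λ l → trivial (ι n) (seq (x o w) l) (seq (x i w) l) (S i l))
        (Null-+ (fᵢ w) Sᵢ₀))))
    where
    S : ∀ j → ℕ → ℚ
    S j l = sum (λ v → seq (x j v) l)
    S-cauchy : ∀ j → IsCauchy (S j)
    S-cauchy j ε 0<ε with cauchy (sumℝ (x j)) ε 0<ε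
    ... | N , h = N , λ p q N≤p N≤q →
      subst₂ (λ a b → abs (a - b) ≤ ε) (seq-sumℝ (x j) p) (seq-sumℝ (x j) q) (h p q N≤p N≤q)
    trivial : ∀ n a b s → n * b - s + s ≡ n * (0ℚ * a + 1ℚ * b)
    trivial = solve 4 (λ n a b s → n :* b :- s :+ s := n :* (con 0ℚ :* a :+ con 1ℚ :* b)) refl
      where open +-*-Solver
    swap : ∀ n a b s t → t * (n * b - s) + - (s * (n * a - t)) ≡ n * (- s * a + t * b)
    swap = solve 5 (λ n a b s t → t :* (n :* b :- s) :+ (:- (s :* (n :* a :- t))) := n :* ((:- s) :* a :+ t :* b)) refl
      where open +-*-Solver
    Sᵢ₀ : Null (S i)
    Sᵢ₀ = Null-cong (λ l → trans (neg-involutive (seq (sumℝ (x i)) l)) (seq-sumℝ (x i) l))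
      (Null-neg (proj₁ (independent-pair indep o≢i (-ℝ sumℝ (x i)) (sumℝ (x o)) λ w →
        Null-ι-cancel 1≤n (Null-cong
          (λ l → trans (swap (ι n) (seq (x o w) l) (seq (x i w) l) (S i l) (S o l))
            (cong₂ (λ s t → ι n * (- s * seq (x o w) l + t * seq (x i w) l)) (sym (seq-sumℝ (x i) l)) (sym (seq-sumℝ (x o) l))))
          (Null-+ {λ l → S o l * centred (x i) w l} {λ l → - (S i l * centred (x o) w l)}
            (Null-* {S o} {centred (x i) w} (S-cauchy o) (fᵢ w))
            (Null-neg {λ l → S i l * centred (x o) w l} (Null-* {S i} {centred (x o) w} (S-cauchy i) (fₒ w))))))))
      where
      neg-involutive : ∀ p → - (- p) ≡ p
      neg-involutive = solve 1 (λ p → :- (:- p) := p) refl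
        where open +-*-Solver

  sum-const-ℚ : ∀ n x → sum {n} (λ _ → x) ≡ ι n * x
  sum-const-ℚ zero    x = sym (ℚ.*-zeroˡ x)
  sum-const-ℚ (suc n) x = begin
    x + sum {n} (λ _ → x)  ≡⟨ cong (x +_) (sum-const-ℚ n x) ⟩
    x + ι n * x            ≡⟨ factor x (ι n) ⟩
    (1ℚ + ι n) * x         ≡⟨ cong (_* x) (ι-+ 1 n) ⟨
    ι (suc n) * x ∎
    where
    open ≡-Reasoning
    factor : ∀ x y → x + y * x ≡ (1ℚ + y) * x
    factor = solve 2 (λ x y → x :+ y :* x := (con 1ℚ :+ y) :* x) refl
      where open +-*-Solver

  sum-linear : ∀ {n} p q (f g : Fin n → ℚ) → sum (λ i → p * f i - q * g i) ≡ p * sum f - q * sum g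
  sum-linear p q f g = begin
    sum (λ i → p * f i - q * g i)                 ≡⟨ sum-cong-≗ (λ i → cong (p * f i +_) (ℚ.neg-distribˡ-* q (g i))) ⟩
    sum (λ i → p * f i + - q * g i)               ≡⟨ ∑-distrib-+ (λ i → p * f i) (λ i → - q * g i) ⟩
    sum (λ i → p * f i) + sum (λ i → - q * g i)   ≡⟨ cong₂ _+_ (*-distribˡ-sum p f) (*-distribˡ-sum (- q) g) ⟨
    p * sum f + - q * sum g                       ≡⟨ cong (p * sum f +_) (ℚ.neg-distribˡ-* q (sum g)) ⟨
    p * sum f - q * sum g ∎
    where open ≡-Reasoning

  -- Eigenvectors with a large eigenvalue are constant

  module Eigenvectors {n} (X : Graph n) (dist : Fin n → Fin n → ℕ)
    (dist-Dist : ∀ u v → Dist X u v (dist u v))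
    {a b c : ℕ → ℕ} (array : IsIntersectionArray X a b c)
    {k : ℕ} (regular : Regular X k) {d : ℕ} (diameter : HasDiameter X d) where

    open DistanceRegular X dist dist-Dist array regular diameter
    open Spectral X dist dist-Dist array regular diameter

    -- Pair with the all-ones vector, whose neighbour sums are all `k`.
    sum-nbℚ : ∀ f → sum (nbℚ f) ≡ ι k * sum f
    sum-nbℚ f = begin
      sum (nbℚ f)                            ≡⟨ sum-cong-≗ (λ w → sym (ℚ.*-identityˡ (nbℚ f w))) ⟩
      sum (λ w → 1ℚ * nbℚ f w)               ≡⟨ nbℚ-adjoint (λ _ → 1ℚ) f ⟩
      sum (λ w → f w * nbℚ (λ _ → 1ℚ) w)
        ≡⟨ sum-cong-≗ (λ w → trans (cong (f w *_) (trans (nbℚ-ι (λ _ → 1) w) (cong ι (nb-1 w)))) (ℚ.*-comm (f w) (ι k))) ⟩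
      sum (λ w → ι k * f w)                  ≡⟨ *-distribˡ-sum (ι k) f ⟨
      ι k * sum f ∎
      where open ≡-Reasoning

    -- Subtracting the mean from an approximate eigenvector keeps it one: the
    -- residuals r satisfy (k - θ) · ∑ f = ∑ r.
    module Centre (f : Fin n → ℚ) (θ : ℚ) where

      r f° : Fin n → ℚ
      r  w = nbℚ f w - θ * f w
      f° w = ι n * f w - sum f

      sum-f° : sum f° ≡ 0ℚ
      sum-f° = begin
        sum f°
          ≡⟨ sum-cong-≗ (λ w → cong (λ x → ι n * f w - x) (sym (ℚ.*-identityˡ (sum f)))) ⟩
        sum (λ w → ι n * f w - 1ℚ * sum f) ≡⟨ sum-linear (ι n) 1ℚ f (λ _ → sum f) ⟩
        ι n * sum f - 1ℚ * sum {n} (λ _ → sum f) ≡⟨ cong (λ x → ι n * sum f - 1ℚ * x) (sum-const-ℚ n (sum f)) ⟩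
        ι n * sum f - 1ℚ * (ι n * sum f)  ≡⟨ cancel (ι n * sum f) ⟩
        0ℚ ∎
        where
        open ≡-Reasoning
        cancel : ∀ x → x - 1ℚ * x ≡ 0ℚ
        cancel = solve 1 (λ x → x :- con 1ℚ :* x := con 0ℚ) refl
          where open +-*-Solver

      sum-r : sum r ≡ ι k * sum f - θ * sum f
      sum-r = begin
        sum r
          ≡⟨ sum-cong-≗ (λ w → cong (_- θ * f w) (sym (ℚ.*-identityˡ (nbℚ f w)))) ⟩
        sum (λ w → 1ℚ * nbℚ f w - θ * f w)       ≡⟨ sum-linear 1ℚ θ (nbℚ f) f ⟩
        1ℚ * sum (nbℚ f) - θ * sum f
          ≡⟨ cong (_- θ * sum f) (trans (ℚ.*-identityˡ (sum (nbℚ f))) (sum-nbℚ f)) ⟩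
        ι k * sum f - θ * sum f ∎
        where open ≡-Reasoning

      nbℚ-f° : ∀ w → nbℚ f° w ≡ ι n * nbℚ f w - ι k * sum f
      nbℚ-f° w = begin
        nbℚ f° w
          ≡⟨ sum-cong-≗ (λ z → expand (ι (A w z)) (ι n) (f z) (sum f)) ⟩
        sum (λ z → ι n * (ι (A w z) * f z) - sum f * (ι (A w z) * 1ℚ))
          ≡⟨ sum-linear (ι n) (sum f) (λ z → ι (A w z) * f z) (λ z → ι (A w z) * 1ℚ) ⟩
        ι n * nbℚ f w - sum f * nbℚ (λ _ → 1ℚ) w
          ≡⟨ cong (λ x → ι n * nbℚ f w - x) (trans (cong (sum f *_) (trans (nbℚ-ι (λ _ → 1) w) (cong ι (nb-1 w)))) (ℚ.*-comm (sum f) (ι k))) ⟩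
        ι n * nbℚ f w - ι k * sum f ∎
        where
        open ≡-Reasoning
        expand : ∀ a n x s → a * (n * x - s) ≡ n * (a * x) - s * (a * 1ℚ)
        expand = solve 4 (λ a n x s → a :* (n :* x :- s) := n :* (a :* x) :- s :* (a :* con 1ℚ)) refl
          where open +-*-Solver

      residual° : ∀ w → nbℚ f° w - θ * f° w ≡ ι n * r w - sum r
      residual° w = begin
        nbℚ f° w - θ * f° w                                     ≡⟨ cong (_- θ * f° w) (nbℚ-f° w) ⟩
        ι n * nbℚ f w - ι k * sum f - θ * (ι n * f w - sum f)   ≡⟨ regroup (ι n) (nbℚ f w) (ι k) (sum f) θ (f w) ⟩
        ι n * r w - (ι k * sum f - θ * sum f)                   ≡⟨ cong (λ x → ι n * r w - x) sum-r ⟨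
        ι n * r w - sum r ∎
        where
        open ≡-Reasoning
        regroup : ∀ n y k s θ x → n * y - k * s - θ * (n * x - s) ≡ n * (y - θ * x) - (k * s - θ * s)
        regroup = solve 6 (λ n y k s θ x → n :* y :- k :* s :- θ :* (n :* x :- s) := n :* (y :- θ :* x) :- (k :* s :- θ :* s)) refl
          where open +-*-Solver

      residual°-bound : ∀ {δ} → (∀ w → abs (r w) ≤ δ) → ∀ w → abs (nbℚ f° w - θ * f° w) ≤ ι n * δ + ι n * δ
      residual°-bound {δ} r≤δ w = begin
        abs (nbℚ f° w - θ * f° w)         ≡⟨ cong abs (residual° w) ⟩
        abs (ι n * r w - sum r)           ≤⟨ ℚ.∣p-q∣≤∣p∣+∣q∣ (ι n * r w) (sum r) ⟩
        abs (ι n * r w) + abs (sum r)     ≤⟨ ℚ.+-mono-≤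
            (ℚ.≤-trans (ℚ.≤-reflexive (trans (ℚ.∣p*q∣≡∣p∣*∣q∣ (ι n) (r w)) (cong (_* abs (r w)) (ℚ.0≤p⇒∣p∣≡p (0≤ι n)))))
                       (*-monoʳ (0≤ι n) (r≤δ w)))
            (ℚ.≤-trans (∣sum∣≤ r) (ℚ.≤-trans (sum-mono-≤ r≤δ) (ℚ.≤-reflexive (sum-const-ℚ n δ)))) ⟩
        ι n * δ + ι n * δ ∎
        where open ℚ.≤-Reasoning

    seq-adjacency : ∀ u v l → seq (adjacency X u v) l ≡ ι (A u v)
    seq-adjacency u v l with adj? X u v
    ... | yes _ = refl
    ... | no _  = refl

    residual-null : ∀ {x θ} → (∀ u → matVec (adjacency X) x u ≈ℝ θ *ℝ x u) →
      ∀ w → Null (λ l → nbℚ (λ z → seq (x z) l) w - seq θ l * seq (x w) l)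
    residual-null {x} {θ} eigen w = Null-cong (λ l → cong (_- seq θ l * seq (x w) l)
      (trans (seq-sumℝ (λ v → adjacency X w v *ℝ x v) l)
             (sum-cong-≗ λ z → cong (_* seq (x z) l) (seq-adjacency w z l)))) (_≈ℝ_.approx (eigen w))

    module _ {η : ℚ} (0≤η : 0ℚ ≤ η) {Δ t} (1≤Δ : 1 ℕ.≤ Δ) (1≤k : 1 ℕ.≤ k) (t≤d : t ℕ.≤ d)
             (b-large : ∀ i → i ℕ.< t → k ℕ.≤ Δ ℕ.* b i) (dominant : ∀ u → 4 ℕ.* n ℕ.≤ 5 ℕ.* K u t)
             (small : ι 2 * (ι ((2 ℕ.* Δ) ℕ.^ t) * η) ≤ 1ℚ) where

      -- For each late `l` the vector `f°` has sum zero and small residuals, so `max-bound` applies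
      -- at a maximum of its absolute value. That vertex may change with `l`, which is why
      -- `dominant` is asked at every vertex.
      centred-null : ∀ {x θ} → (∀ u → matVec (adjacency X) x u ≈ℝ θ *ℝ x u) →
        (∃[ N ] (∀ l → N ℕ.≤ l → ι k * (1ℚ - η) ≤ abs (seq θ l))) → ∀ w → Null (centred x w)
      centred-null {x} {θ} eigen (M , θ-large) w ε 0<ε =
        let δ , 0<δ , Cδ≤ε = shrink {C} 0≤C 0<ε
            N , r≤δ = Null-uniform _ (residual-null {x} {θ} eigen) δ 0<δ
        in M ℕ.⊔ N , λ l le →
          bound l δ Cδ≤ε (θ-large l (ℕ.m⊔n≤o⇒m≤o M N le)) (r≤δ l (ℕ.m⊔n≤o⇒n≤o M N le))
        where
        open ℚ.≤-Reasoning
        Q C : ℚ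
        Q = ι ((2 ℕ.* Δ) ℕ.^ t)
        -- The factor of `max-bound` times the `n + n` by which centring enlarges the residual.
        C = ι 4 * Q * (ι n + ι n)
        0≤C : 0ℚ ≤ C
        0≤C = *≥0 (*≥0 (0≤ι 4) (0≤ι ((2 ℕ.* Δ) ℕ.^ t))) (+≥0 (0≤ι n) (0≤ι n))
        regroup : ∀ q n δ → ι 4 * q * (n * δ + n * δ) ≡ ι 4 * q * (n + n) * δ
        regroup = solve 3 (λ q n δ → con (ι 4) :* q :* (n :* δ :+ n :* δ) := con (ι 4) :* q :* (n :+ n) :* δ) refl
          where open +-*-Solver
        bound : ∀ l δ → C * δ ≤ ε → ι k * (1ℚ - η) ≤ abs (seq θ l) →
          (∀ w → abs (nbℚ (λ z → seq (x z) l) w - seq θ l * seq (x w) l) ≤ δ) → abs (centred x w l) ≤ ε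
        bound l δ Cδ≤ε θ-large r≤δ =
          let u , u-max = argmax w (abs ∘ f°) in begin
          abs (f° w)                       ≤⟨ u-max w ⟩
          abs (f° u)
            ≤⟨ Approx.max-bound f° (seq θ l) (ι n * δ + ι n * δ) (residual°-bound r≤δ) u u-max
                                                0≤η θ-large 1≤Δ 1≤k t≤d b-large sum-f° (dominant u) small ⟩
          ι 4 * Q * (ι n * δ + ι n * δ)    ≡⟨ regroup Q (ι n) δ ⟩
          C * δ                            ≤⟨ Cδ≤ε ⟩
          ε ∎
          where open Centre (λ z → seq (x z) l) (seq θ l)

  -- The spectral bound

  abstract
    ≤-limit : ∀ {p q} → (∀ ε → 0ℚ < ε → p ≤ q + ε) → p ≤ q
    ≤-limit {p} {q} h = ℚ.≮⇒≥ λ q<p →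
      let r , q<r , r<p = ℚ.<-dense q<p
          0<r-q = subst (_< r - q) (ℚ.+-inverseʳ q) (ℚ.+-monoˡ-< (- q) q<r)
      in ℚ.<-irrefl refl (ℚ.≤-<-trans (subst (p ≤_) (back q r) (h (r - q) 0<r-q)) r<p)
      where
      back : ∀ q r → q + (r - q) ≡ r
      back = solve 2 (λ q r → q :+ (r :- q) := r) refl
        where open +-*-Solver

    ≤∣-∣ : ∀ p → p ≤ abs p
    ≤∣-∣ p with ℚ.≤-total 0ℚ p
    ... | inj₁ 0≤p = ℚ.≤-reflexive (sym (ℚ.0≤p⇒∣p∣≡p 0≤p))
    ... | inj₂ p≤0 = ℚ.≤-trans p≤0 (ℚ.0≤∣p∣ p)

    ≤+∣-∣ : ∀ p q → p ≤ q + abs (p - q)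
    ≤+∣-∣ p q = subst (_≤ q + abs (p - q)) (back p q) (ℚ.+-monoʳ-≤ q (≤∣-∣ (p - q)))
      where
      back : ∀ p q → q + (p - q) ≡ p
      back = solve 2 (λ p q → q :+ (p :- q) := p) refl
        where open +-*-Solver

  -- Whether x exceeds q by a margin can be read off a single sufficiently late term.
  ≤-from-¬large : ∀ {x ξ q} → ξ ≈ℝ x → ¬ (∃[ N ] (∀ l → N ℕ.≤ l → q ≤ seq x l)) →
    ∀ ε → 0ℚ < ε → ∃[ N ] (∀ l → N ℕ.≤ l → seq ξ l ≤ q + ε)
  ≤-from-¬large {x} {ξ} {q} ξ≈x ¬large ε 0<ε = decide (seq x M ℚ.≤? q + h)
    where
    open ℚ.≤-Reasoning
    h : ℚ
    -- One quarter of `ε` for the threshold, one for the oscillation of `x` after `M`, and the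
    -- remaining half for the distance between `ξ` and `x`.
    h = ½ * (½ * ε)
    0<h : 0ℚ < h
    0<h = half>0 (half>0 0<ε)
    M N : ℕ
    M = proj₁ (cauchy x h 0<h)
    N = proj₁ (_≈ℝ_.approx ξ≈x (½ * ε) (half>0 0<ε))
    near : ∀ l l′ → M ℕ.≤ l → M ℕ.≤ l′ → seq x l ≤ seq x l′ + h
    near l l′ M≤l M≤l′ = ℚ.≤-trans (≤+∣-∣ (seq x l) (seq x l′))
      (ℚ.+-monoʳ-≤ (seq x l′) (proj₂ (cauchy x h 0<h) l l′ M≤l M≤l′))
    close : ∀ l → N ℕ.≤ l → seq ξ l ≤ seq x l + ½ * ε
    close l N≤l = ℚ.≤-trans (≤+∣-∣ (seq ξ l) (seq x l))
      (ℚ.+-monoʳ-≤ (seq x l) (proj₂ (_≈ℝ_.approx ξ≈x (½ * ε) (half>0 0<ε)) l N≤l))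
    decide : Dec (seq x M ≤ q + h) → ∃[ N ] (∀ l → N ℕ.≤ l → seq ξ l ≤ q + ε)
    decide (yes xM≤) = M ℕ.⊔ N , λ l le → begin
      seq ξ l               ≤⟨ close l (ℕ.m⊔n≤o⇒n≤o M N le) ⟩
      seq x l + ½ * ε       ≤⟨ ℚ.+-monoˡ-≤ (½ * ε) (near l M (ℕ.m⊔n≤o⇒m≤o M N le) ℕ.≤-refl) ⟩
      seq x M + h + ½ * ε   ≤⟨ ℚ.+-monoˡ-≤ (½ * ε) (ℚ.+-monoˡ-≤ h xM≤) ⟩
      q + h + h + ½ * ε     ≡⟨ total q ε ⟩
      q + ε ∎
      where
      total : ∀ q ε → q + ½ * (½ * ε) + ½ * (½ * ε) + ½ * ε ≡ q + ε
      total = solve 2 (λ q ε → q :+ con ½ :* (con ½ :* ε) :+ con ½ :* (con ½ :* ε) :+ con ½ :* ε := q :+ ε) refl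
        where open +-*-Solver
    -- The term at `M` exceeds `q` by more than the later oscillation `h`, so all later terms stay
    -- above `q`.
    decide (no xM≰) = ⊥-elim (¬large (M , λ l M≤l →
      ≤-by (0≤-by (ℚ.≤-trans (ℚ.<⇒≤ (ℚ.≰⇒> xM≰)) (near M l ℕ.≤-refl M≤l))) (shift (seq x l) q h)))
      where
      shift : ∀ x q h → x - q ≡ x + h - (q + h)
      shift = solve 3 (λ x q h → x :- q := x :+ h :- (q :+ h)) refl
        where open +-*-Solver

  -- With `e = 1 / (M + 1)` the factor `1 - e` is `M / (M + 1)`; the inequality of constant real
  -- sequences passes to rationals by `≤-limit`, and the denominator is cleared.
  dominant-ℕ : ∀ {M n kₜ e} → ι (suc M) * e ≡ 1ℚ →
    (1ℝ -ℝ fromℚ e) *ℝ fromℕ n ≤ℝ fromℕ kₜ → M ℕ.* n ℕ.≤ suc M ℕ.* kₜ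
  dominant-ℕ {M} {n} {kₜ} {e} Me≡1 (mk≤ bound) = ι-cancel-≤ (begin
    ι (M ℕ.* n)                        ≡⟨ ι-* M n ⟩
    ι M * ι n                          ≡⟨ cong (_* ι n) ιM ⟩
    ι (suc M) * (1ℚ - e) * ι n         ≡⟨ ℚ.*-assoc (ι (suc M)) (1ℚ - e) (ι n) ⟩
    ι (suc M) * ((1ℚ - e) * ι n)
      ≤⟨ *-monoʳ (0≤ι (suc M)) (≤-limit λ ε 0<ε → let N , h = bound ε 0<ε in h N ℕ.≤-refl) ⟩
    ι (suc M) * ι kₜ                   ≡⟨ ι-* (suc M) kₜ ⟨
    ι (suc M ℕ.* kₜ) ∎)
    where
    open ℚ.≤-Reasoning
    expand : ∀ m e → (1ℚ + m) * (1ℚ - e) ≡ 1ℚ + m - (1ℚ + m) * e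
    expand = solve 2 (λ m e → (con 1ℚ :+ m) :* (con 1ℚ :- e) := con 1ℚ :+ m :- (con 1ℚ :+ m) :* e) refl
      where open +-*-Solver
    drop : ∀ m → m ≡ 1ℚ + m - 1ℚ
    drop = solve 1 (λ m → m := con 1ℚ :+ m :- con 1ℚ) refl
      where open +-*-Solver
    ιM : ι M ≡ ι (suc M) * (1ℚ - e)
    ιM = begin-equality
      ι M                                 ≡⟨ drop (ι M) ⟩
      1ℚ + ι M - 1ℚ                       ≡⟨ cong (λ x → 1ℚ + ι M - x) Me≡1 ⟨
      1ℚ + ι M - ι (suc M) * e            ≡⟨ cong (λ x → 1ℚ + ι M - x * e) (ι-+ 1 M) ⟩
      1ℚ + ι M - (1ℚ + ι M) * e           ≡⟨ expand (ι M) e ⟨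
      (1ℚ + ι M) * (1ℚ - e)               ≡⟨ cong (_* (1ℚ - e)) (ι-+ 1 M) ⟨
      ι (suc M) * (1ℚ - e) ∎

  complement-small : ∀ {M n κ j} → M ℕ.* n ℕ.≤ suc M ℕ.* κ → j ℕ.+ κ ℕ.≤ n → M ℕ.* j ℕ.≤ κ
  complement-small {M} {n} {κ} {j} le j+κ≤n = ℕ.+-cancelʳ-≤ (M ℕ.* κ) _ _ (begin
    M ℕ.* j ℕ.+ M ℕ.* κ   ≡⟨ ℕ.*-distribˡ-+ M j κ ⟨
    M ℕ.* (j ℕ.+ κ)       ≤⟨ ℕ.*-monoʳ-≤ M j+κ≤n ⟩
    M ℕ.* n               ≤⟨ le ⟩
    κ ℕ.+ M ℕ.* κ         ∎)
    where open ℕ.≤-Reasoning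

  four-fifths : ∀ {M n κ} → 4 ℕ.≤ M → κ ℕ.≤ n → M ℕ.* n ℕ.≤ suc M ℕ.* κ → 4 ℕ.* n ℕ.≤ 5 ℕ.* κ
  four-fifths {M} {n} {κ} 4≤M κ≤n le = begin
    4 ℕ.* n                         ≡⟨ cong (4 ℕ.*_) (ℕ.m∸n+n≡m κ≤n) ⟨
    4 ℕ.* (n ℕ.∸ κ ℕ.+ κ)           ≡⟨ ℕ.*-distribˡ-+ 4 (n ℕ.∸ κ) κ ⟩
    4 ℕ.* (n ℕ.∸ κ) ℕ.+ 4 ℕ.* κ     ≤⟨ ℕ.+-monoˡ-≤ (4 ℕ.* κ) (ℕ.≤-trans (ℕ.*-monoˡ-≤ (n ℕ.∸ κ) 4≤M)
                                         (complement-small {M} le (ℕ.≤-reflexive (ℕ.m∸n+n≡m κ≤n)))) ⟩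
    κ ℕ.+ 4 ℕ.* κ ∎
    where open ℕ.≤-Reasoning

  -- In the theorem ε = 1 / (M d + 1) and η = 1 / (2 Q d); below the dominant
  -- distance every bᵢ is at least k / Δ d.
  Δ Q M : ℕ → ℕ
  Δ d = (4 ℕ.* d) ℕ.^ d
  Q d = (2 ℕ.* Δ d) ℕ.^ d
  M d = 2 ℕ.* (1 ℕ.+ d)

  module _ {d} (2≤d : 2 ℕ.≤ d) where

    1≤4d : 1 ℕ.≤ 4 ℕ.* d
    1≤4d = ℕ.≤-trans (s≤s z≤n) (ℕ.*-monoʳ-≤ 4 2≤d)

    1≤Δ : 1 ℕ.≤ Δ d
    1≤Δ = ℕ.m^n>0 (4 ℕ.* d) {{ℕ.>-nonZero 1≤4d}} d

    1≤2Δ : 1 ℕ.≤ 2 ℕ.* Δ d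
    1≤2Δ = ℕ.≤-trans 1≤Δ (ℕ.m≤n*m (Δ d) 2)

    1≤2Q : 1 ℕ.≤ 2 ℕ.* Q d
    1≤2Q = ℕ.≤-trans (ℕ.m^n>0 (2 ℕ.* Δ d) {{ℕ.>-nonZero 1≤2Δ}} d) (ℕ.m≤n*m (Q d) 2)

  module Bound {d} (2≤d : 2 ℕ.≤ d) {e h : ℚ} (0<h : 0ℚ < h) (Me≡1 : ι (suc (M d)) * e ≡ 1ℚ)
    (2Qh≡1 : ι (2 ℕ.* Q d) * h ≡ 1ℚ)
    {n k} (X : Graph n) (dr : IsDistanceRegular X d) (regular : Regular X k)
    {s} (s<d : suc s ℕ.≤ d) (v : Fin n) {kₜ} (size : SphereSize X v (suc s) kₜ)
    (dom : (1ℝ -ℝ fromℚ e) *ℝ fromℕ n ≤ℝ fromℕ kₜ) where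

    open IsDistanceRegular dr

    dist : Fin n → Fin n → ℕ
    dist u v = proj₁ (distance X connected u v)

    dist-Dist : ∀ u v → Dist X u v (dist u v)
    dist-Dist u v = proj₂ (distance X connected u v)

    open DistanceRegular X dist dist-Dist array regular diameter
    open Growth X dist dist-Dist array regular diameter
    open Eigenvectors X dist dist-Dist array regular diameter

    dominant : ∀ u → M d ℕ.* n ℕ.≤ suc (M d) ℕ.* K u (suc s)
    dominant u = subst (λ x → M d ℕ.* n ℕ.≤ suc (M d) ℕ.* x)
      (trans (sym (SphereSize⇒K size)) (K-const v u s<d)) (dominant-ℕ {M d} {n} {kₜ} Me≡1 dom)

    K≤n : ∀ u → K u (suc s) ℕ.≤ n
    K≤n u = ℕ.≤-trans (ℕ.m≤n+m _ _) (K-disjoint u {s} {suc s} λ ())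

    1≤k : 1 ℕ.≤ k
    1≤k = ℕ.≤-trans (c-positive 1≤d) (subst (c 1 ℕ.≤_) (c+a+b≡k 1≤d) (ℕ.≤-trans (ℕ.m≤m+n (c 1) (a 1)) (ℕ.m≤m+n _ (b 1))))
      where
      1≤d : 1 ℕ.≤ d
      1≤d = ℕ.≤-trans (s≤s z≤n) 2≤d

    -- The spheres of radii `s` and `suc s` are disjoint, so the first is smaller by a factor `M d`.
    -- This gives the hypothesis of `b-large` at `s`; its constant is then enlarged from exponent
    -- `i` to `d`.
    k≤Δb : ∀ i → i ℕ.< suc s → k ℕ.≤ Δ d ℕ.* b i
    k≤Δb i i<t = ℕ.≤-trans (b-large {M = M d} ℕ.≤-refl s<d
        (K-ratio⇒c-ratio v {M d} (ℕ.<⇒≤ s<d) (complement-small {M d} (dominant v) (K-disjoint v {s} {suc s} λ ())))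
        i (ℕ.≤-pred i<t))
      (ℕ.*-monoˡ-≤ (b i) (ℕ.^-monoʳ-≤ (4 ℕ.* d) {{ℕ.>-nonZero (1≤4d 2≤d)}} (ℕ.≤-trans (ℕ.<⇒≤ i<t) s<d)))

    small : ι 2 * (ι ((2 ℕ.* Δ d) ℕ.^ suc s) * h) ≤ 1ℚ
    small = begin
      ι 2 * (ι ((2 ℕ.* Δ d) ℕ.^ suc s) * h)   ≤⟨ *-monoʳ (0≤ι 2) (ℚ.*-monoʳ-≤-nonNeg h {{nonNegative (ℚ.<⇒≤ 0<h)}}
                                                   (ι-mono (ℕ.^-monoʳ-≤ (2 ℕ.* Δ d) {{ℕ.>-nonZero (1≤2Δ 2≤d)}} s<d))) ⟩
      ι 2 * (ι (Q d) * h)                     ≡⟨ ℚ.*-assoc (ι 2) (ι (Q d)) h ⟨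
      ι 2 * ι (Q d) * h                       ≡⟨ cong (_* h) (ι-* 2 (Q d)) ⟨
      ι (2 ℕ.* Q d) * h                       ≡⟨ 2Qh≡1 ⟩
      1ℚ ∎
      where open ℚ.≤-Reasoning

    centred₀ : ∀ {x θ} → (∀ u → matVec (adjacency X) x u ≈ℝ θ *ℝ x u) →
      (∃[ N ] (∀ l → N ℕ.≤ l → ι k * (1ℚ - h) ≤ abs (seq θ l))) → ∀ w → Null (centred x w)
    centred₀ {x} {θ} = centred-null (ℚ.<⇒≤ 0<h) (1≤Δ 2≤d) 1≤k s<d k≤Δb
      -- `M d = 2 * (1 + d)` is at least 4 because `d` is at least 2.
      (λ u → four-fifths {M d} (ℕ.*-monoʳ-≤ 2 (ℕ.≤-trans 2≤d (ℕ.n≤1+n d))) (K≤n u) (dominant u)) small {x} {θ}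

    -- The slack `k * h` is positive, so terms converging to `k` are eventually large enough. The
    -- eigenvector of `k` is thereby found constant by the same argument as any other.
    principal-large : ∀ {θ} → θ ≈ℝ fromℕ k → ∃[ N ] (∀ l → N ℕ.≤ l → ι k * (1ℚ - h) ≤ abs (seq θ l))
    principal-large {θ} (mk≈ approx) =
      let N , close = approx (ι k * h) (*>0 (0<ι 1≤k) 0<h)
      in N , λ l N≤l → ≤-by (+≥0 (0≤-by (≤+∣-∣ (ι k) (seq θ l)))
                           (+≥0 (0≤-by (subst (_≤ ι k * h) (∣-∣-sym (seq θ l) (ι k)) (close l N≤l)))
                                (0≤-by (≤∣-∣ (seq θ l)))))
                       (certificate (ι k) h (seq θ l) (abs (seq θ l)) (abs (ι k - seq θ l)))
      where
      flip : ∀ p q → - (p - q) ≡ q - p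
      flip = solve 2 (λ p q → :- (p :- q) := q :- p) refl
        where open +-*-Solver
      ∣-∣-sym : ∀ p q → abs (p - q) ≡ abs (q - p)
      ∣-∣-sym p q = trans (sym (ℚ.∣-p∣≡∣p∣ (p - q))) (cong abs (flip p q))
      certificate : ∀ k h t u v → u - k * (1ℚ - h) ≡ (t + v - k) + ((k * h - v) + (u - t))
      certificate = solve 5 (λ k h t u v → u :- k :* (con 1ℚ :- h) := (t :+ v :- k) :+ ((k :* h :- v) :+ (u :- t))) refl
        where open +-*-Solver

    radius-bound : ∀ {ξ} → IsZeroWeightSpectralRadius X k ξ → ξ ≤ℝ fromℕ k *ℝ (1ℝ -ℝ fromℚ h)
    radius-bound {ξ} radius = mk≤ (≤-from-¬large {∣ θ i ∣ℝ} ξ≈∣θᵢ∣ ¬large)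
      where
      open IsZeroWeightSpectralRadius radius
      open IsEigenvalueList eigenvalues
      i : Fin n
      i = proj₁ attained
      ξ≈∣θᵢ∣ : ξ ≈ℝ ∣ θ i ∣ℝ
      ξ≈∣θᵢ∣ = proj₂ (proj₂ attained)
      index₀ : ∀ {n} → Fin n → ∃[ o ] (toℕ {n} o ≡ 0)
      index₀ zero    = zero , refl
      index₀ (suc _) = zero , refl
      -- The vertex `v` shows that there is an index 0.
      o : Fin n
      o = proj₁ (index₀ v)
      o≡0 : toℕ o ≡ 0
      o≡0 = proj₂ (index₀ v)
      o≢i : o ≢ i
      o≢i o≡i = ℕ.<⇒≢ (proj₁ (proj₂ attained)) (sym (trans (cong toℕ (sym o≡i)) o≡0))
      1≤n : 1 ℕ.≤ n
      1≤n = ℕ.≤-trans (K-positive v s<d) (K≤n v)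
      ¬large : ¬ (∃[ N ] (∀ l → N ℕ.≤ l → ι k * (1ℚ - h) ≤ abs (seq (θ i) l)))
      ¬large large = not-both-constant independent o≢i 1≤n
        (centred₀ {eigenvector o} {θ o} (eigen o) (principal-large (principal o o≡0)))
        (centred₀ {eigenvector i} {θ i} (eigen i) large)

  fromℚ-positive : ∀ {q} → 0ℚ < q → 0ℝ <ℝ fromℚ q
  fromℚ-positive {q} 0<q = mk< q 0<q (0 , λ _ _ → ℚ.≤-reflexive (ℚ.+-identityˡ q))

open import Data.Nat.Base using (_≤_)

theorem3 : (d : ℕ) → 2 ≤ d →
    ∃[ ε ] ∃[ η ] (0ℝ <ℝ ε × 0ℝ <ℝ η ×
    ((n k : ℕ) (X : Graph n) → IsDistanceRegular X d → Regular X k →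
    (t : ℕ) → 1 ≤ t → t ≤ d →
    (v : Fin n) (kₜ : ℕ) → SphereSize X v t kₜ →
    (1ℝ -ℝ ε) *ℝ fromℕ n ≤ℝ fromℕ kₜ →
    (ξ : ℝ) → IsZeroWeightSpectralRadius X k ξ →
    ξ ≤ℝ fromℕ k *ℝ (1ℝ -ℝ η)))
theorem3 d 2≤d =
  let e , 0<e , Me≡1 = reciprocal (0<ι {suc (M d)} (s≤s z≤n))
      h , 0<h , 2Qh≡1 = reciprocal (0<ι (1≤2Q 2≤d))
  in fromℚ e , fromℚ h , fromℚ-positive 0<e , fromℚ-positive 0<h ,
     λ { n k X dr regular (suc s) _ s<d v kₜ size dom ξ radius →
         Bound.radius-bound 2≤d 0<h Me≡1 2Qh≡1 X dr regular s<d v size dom radius }
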